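{- Let $\epsilon=\pm1$, $0<q\in\mathbb{Q}$, $\gamma\in\mathbb{N}$, $\delta\in\mathbb{N}\cup\{0\}$ and $N\in\mathbb{N}$. Then the power series $$\phi_{\gamma,\delta}^{\epsilon,q}(x)=\sum_{n=0}^{\infty}\epsilon^n\,\frac{((\gamma n+\delta)!)^{\gamma n+\delta}}{q+((\gamma n+\delta)!)^{N(\gamma n+\delta)}}\,\frac{x^{\gamma n+\delta}}{(\gamma n+\delta)!}$$ converges for all $x\in\mathbb{R}$, and converges for all $x\in\mathbb{Q}_p$ for every prime $p$.
   Context: $\mathbb{N}$ denotes the positive integers. $\mathbb{Q}_p$ is the field of $p$-adic numbers; convergence in $\mathbb{R}$ is with respect to the usual absolute value and in $\mathbb{Q}_p$ with respect to the $p$-adic absolute value. The coefficients are rational numbers, regarded as elements of $\mathbb{R}$ or of $\mathbb{Q}_p$. -}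

module Defs where

open import Algebra.Bundles using (RawSemiring)
import Algebra.Definitions.RawSemiring as RawSemiringDefs
open import Data.Bool.Base using (if_then_else_)
open import Data.Integer.Base as ℤ using (ℤ; +_) renaming (∣_∣ to abs)
import Data.Integer.Properties as ℤ
import Data.Integer.Divisibility.Signed as ℤ
open import Data.Nat.Base as ℕ using (ℕ; zero; suc; _!)
import Data.Nat.Properties as ℕ
open import Data.Nat.Divisibility
  using (_∣_; _∣?_; divides; ∣-trans; ∣⇒≤; *-pres-∣; *-cancelˡ-∣; 1∣_)
open import Data.Nat.Primality
  using (Prime; prime⇒nonZero; prime⇒nonTrivial; euclidsLemma)
open import Data.Nat.Tactic.RingSolver using () renaming (solve-∀ to solveℕ-∀)
open import Data.Product.Base using (∃-syntax; _×_; _,_; proj₁; proj₂)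
open import Data.Rational.Base as ℚ
  using (ℚ; 0ℚ; 1ℚ; ½; _+_; _-_; -_; _*_; _÷_; 1/_; _/_; _<_; _≤_; ↥_; ↧ₙ_; toℚᵘ;
         Positive; positive; nonNegative)
import Data.Rational.Properties as ℚ
open import Data.Rational.Solver using (module +-*-Solver)
open import Data.Rational.Unnormalised.Base as ℚᵘ using (mkℚᵘ; *≡*; *≤*)
import Data.Rational.Unnormalised.Properties as ℚᵘ
open import Data.Sum.Base using (_⊎_; inj₁; inj₂; [_,_]′)
open import Level using (0ℓ)
open import Relation.Binary.Definitions using (tri<; tri≈; tri>)
open import Relation.Binary.PropositionalEquality
open import Relation.Nullary using (¬_; yes; no; does; contradiction)

record AbsoluteValue : Set where
  field
    ∥_∥     : ℚ → ℚ
    0≤∥_∥   : ∀ a → 0ℚ ≤ ∥ a ∥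
    ∥0∥≡0   : ∥ 0ℚ ∥ ≡ 0ℚ
    ∥∥≡0⇒≡0 : ∀ a → ∥ a ∥ ≡ 0ℚ → a ≡ 0ℚ
    ∥*∥     : ∀ a b → ∥ a * b ∥ ≡ ∥ a ∥ * ∥ b ∥
    ∥+∥     : ∀ a b → ∥ a + b ∥ ≤ ∥ a ∥ + ∥ b ∥

IsCauchy : AbsoluteValue → (ℕ → ℚ) → Set
IsCauchy A a =
  ∀ (ε : ℚ) → 0ℚ < ε → ∃[ K ] (∀ m n → K ℕ.≤ m → K ℕ.≤ n → ∥ a m - a n ∥ < ε)
  where open AbsoluteValue A

-- The completion of ℚ is represented by its Cauchy sequences; two of them name the
-- same element when they are related by _≈_ below.
record Completion (A : AbsoluteValue) : Set where
  constructor completed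
  field
    approx : ℕ → ℚ
    cauchy : IsCauchy A approx

open Completion public

module AbsoluteValueProperties (A : AbsoluteValue) where
  open AbsoluteValue A
  open ℚ.≤-Reasoning

  private
    square-injective-< : ∀ {x y} → 0ℚ ≤ x → x < y → x * x ≢ y * y
    square-injective-< {x} {y} 0≤x x<y eq = ℚ.<-irrefl eq (begin-strict
      x * x ≤⟨ ℚ.*-monoˡ-≤-nonNeg x {{nonNegative 0≤x}} (ℚ.<⇒≤ x<y) ⟩
      x * y <⟨ ℚ.*-monoˡ-<-pos y {{positive (ℚ.≤-<-trans 0≤x x<y)}} x<y ⟩
      y * y ∎)

    square-injective : ∀ {x y} → 0ℚ ≤ x → 0ℚ ≤ y → x * x ≡ y * y → x ≡ y
    square-injective {x} {y} 0≤x 0≤y eq with ℚ.<-cmp x y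
    ... | tri< x<y _ _ = contradiction eq (square-injective-< 0≤x x<y)
    ... | tri≈ _ x≡y _ = x≡y
    ... | tri> _ _ y<x = contradiction (sym eq) (square-injective-< 0≤y y<x)

  ∥-a∥≡∥a∥ : ∀ a → ∥ - a ∥ ≡ ∥ a ∥
  ∥-a∥≡∥a∥ a = square-injective 0≤∥ - a ∥ 0≤∥ a ∥ (begin-equality
    ∥ - a ∥ * ∥ - a ∥ ≡⟨ ∥*∥ (- a) (- a) ⟨
    ∥ - a * - a ∥     ≡⟨ cong ∥_∥ (solve 1 (λ x → (:- x) :* (:- x) := x :* x) refl a) ⟩
    ∥ a * a ∥         ≡⟨ ∥*∥ a a ⟩
    ∥ a ∥ * ∥ a ∥     ∎)
    where open +-*-Solver

  ∥a-b∥≡∥b-a∥ : ∀ a b → ∥ a - b ∥ ≡ ∥ b - a ∥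
  ∥a-b∥≡∥b-a∥ a b = trans
    (cong ∥_∥ (solve 2 (λ x y → x :- y := :- (y :- x)) refl a b)) (∥-a∥≡∥a∥ (b - a))
    where open +-*-Solver

  ∥a∥≤∥b∥+∥a-b∥ : ∀ a b → ∥ a ∥ ≤ ∥ b ∥ + ∥ a - b ∥
  ∥a∥≤∥b∥+∥a-b∥ a b = begin
    ∥ a ∥             ≡⟨ cong ∥_∥ (solve 2 (λ x y → x := y :+ (x :- y)) refl a b) ⟩
    ∥ b + (a - b) ∥   ≤⟨ ∥+∥ b (a - b) ⟩
    ∥ b ∥ + ∥ a - b ∥ ∎
    where open +-*-Solver

  ∥∥-difference : ∀ a b → ∥ a ∥ - ∥ b ∥ ≤ ∥ a - b ∥
  ∥∥-difference a b = begin
    ∥ a ∥ - ∥ b ∥             ≤⟨ ℚ.+-monoˡ-≤ (- ∥ b ∥) (∥a∥≤∥b∥+∥a-b∥ a b) ⟩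
    ∥ b ∥ + ∥ a - b ∥ - ∥ b ∥ ≡⟨ solve 2 (λ x y → x :+ y :- x := y) refl (∥ b ∥) (∥ a - b ∥) ⟩
    ∥ a - b ∥                 ∎
    where open +-*-Solver

  reverse-triangle : ∀ a b → ℚ.∣ ∥ a ∥ - ∥ b ∥ ∣ ≤ ∥ a - b ∥
  reverse-triangle a b with ℚ.∣p∣≡p∨∣p∣≡-p (∥ a ∥ - ∥ b ∥)
  ... | inj₁ eq = ℚ.≤-trans (ℚ.≤-reflexive eq) (∥∥-difference a b)
  ... | inj₂ eq = begin
    ℚ.∣ ∥ a ∥ - ∥ b ∥ ∣ ≡⟨ eq ⟩
    - (∥ a ∥ - ∥ b ∥)   ≡⟨ solve 2 (λ x y → :- (x :- y) := y :- x) refl (∥ a ∥) (∥ b ∥) ⟩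
    ∥ b ∥ - ∥ a ∥       ≤⟨ ∥∥-difference b a ⟩
    ∥ b - a ∥           ≡⟨ ∥a-b∥≡∥b-a∥ b a ⟩
    ∥ a - b ∥           ∎
    where open +-*-Solver

  half-positive : ∀ {ε} → 0ℚ < ε → 0ℚ < ½ * ε
  half-positive {ε} 0<ε = ℚ.positive⁻¹ (½ * ε) {{ℚ.pos*pos⇒pos ½ ε {{positive 0<ε}}}}

  half+half : ∀ ε → ½ * ε + ½ * ε ≡ ε
  half+half ε = trans (sym (ℚ.*-distribʳ-+ ε ½ ½)) (ℚ.*-identityˡ ε)

  const-cauchy : ∀ a → IsCauchy A (λ _ → a)
  const-cauchy a ε 0<ε = 0 , λ _ _ _ _ → begin-strict
    ∥ a - a ∥ ≡⟨ cong ∥_∥ (ℚ.+-inverseʳ a) ⟩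
    ∥ 0ℚ ∥    ≡⟨ ∥0∥≡0 ⟩
    0ℚ        <⟨ 0<ε ⟩
    ε         ∎

  +-cauchy : ∀ {a b} → IsCauchy A a → IsCauchy A b → IsCauchy A (λ n → a n + b n)
  +-cauchy {a} {b} ca cb ε 0<ε
    with ca (½ * ε) (half-positive 0<ε) | cb (½ * ε) (half-positive 0<ε)
  ... | K , close-a | L , close-b = K ℕ.⊔ L , λ m n K⊔L≤m K⊔L≤n → begin-strict
    ∥ (a m + b m) - (a n + b n) ∥
      ≡⟨ cong ∥_∥ (solve 4 (λ x y z w → (x :+ y) :- (z :+ w) := (x :- z) :+ (y :- w))
                        refl (a m) (b m) (a n) (b n)) ⟩
    ∥ (a m - a n) + (b m - b n) ∥
      ≤⟨ ∥+∥ (a m - a n) (b m - b n) ⟩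
    ∥ a m - a n ∥ + ∥ b m - b n ∥
      <⟨ ℚ.+-mono-< (close-a m n (ℕ.m⊔n≤o⇒m≤o K L K⊔L≤m) (ℕ.m⊔n≤o⇒m≤o K L K⊔L≤n))
                    (close-b m n (ℕ.m⊔n≤o⇒n≤o K L K⊔L≤m) (ℕ.m⊔n≤o⇒n≤o K L K⊔L≤n)) ⟩
    ½ * ε + ½ * ε
      ≡⟨ half+half ε ⟩
    ε ∎
    where open +-*-Solver

  neg-cauchy : ∀ {a} → IsCauchy A a → IsCauchy A (λ n → - a n)
  neg-cauchy {a} ca ε 0<ε with ca ε 0<ε
  ... | K , close = K , λ m n K≤m K≤n → begin-strict
    ∥ - a m - - a n ∥ ≡⟨ cong ∥_∥ (solve 2 (λ x y → (:- x) :- (:- y) := y :- x) refl (a m) (a n)) ⟩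
    ∥ a n - a m ∥     <⟨ close n m K≤n K≤m ⟩
    ε                 ∎
    where open +-*-Solver

  eventually-bounded : ∀ {a} → IsCauchy A a → ∃[ K ] ∃[ B ] (0ℚ < B × (∀ n → K ℕ.≤ n → ∥ a n ∥ ≤ B))
  eventually-bounded {a} ca with ca 1ℚ (ℚ.positive⁻¹ 1ℚ)
  ... | K , close = K , ∥ a K ∥ + 1ℚ
    , (begin-strict
        0ℚ           <⟨ ℚ.positive⁻¹ 1ℚ ⟩
        1ℚ           ≡⟨ ℚ.+-identityˡ 1ℚ ⟨
        0ℚ + 1ℚ      ≤⟨ ℚ.+-monoˡ-≤ 1ℚ 0≤∥ a K ∥ ⟩
        ∥ a K ∥ + 1ℚ ∎)
    , λ n K≤n → begin
        ∥ a n ∥                 ≤⟨ ∥a∥≤∥b∥+∥a-b∥ (a n) (a K) ⟩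
        ∥ a K ∥ + ∥ a n - a K ∥ ≤⟨ ℚ.+-monoʳ-≤ (∥ a K ∥) (ℚ.<⇒≤ (close n K K≤n ℕ.≤-refl)) ⟩
        ∥ a K ∥ + 1ℚ            ∎

  private
    quotient : ∀ {B ε} → 0ℚ < B → 0ℚ < ε → ∃[ η ] (0ℚ < η × B * η ≡ ½ * ε)
    quotient {B} {ε} 0<B 0<ε = 1/ B * (½ * ε)
      , ℚ.positive⁻¹ (1/ B * (½ * ε))
          {{ℚ.pos*pos⇒pos (1/ B) {{ℚ.1/pos⇒pos B}} (½ * ε) {{positive (half-positive 0<ε)}}}}
      , (begin-equality
          B * (1/ B * (½ * ε)) ≡⟨ ℚ.*-assoc B (1/ B) (½ * ε) ⟨
          B * 1/ B * (½ * ε)   ≡⟨ cong (_* (½ * ε)) (ℚ.*-inverseʳ B) ⟩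
          1ℚ * (½ * ε)         ≡⟨ ℚ.*-identityˡ (½ * ε) ⟩
          ½ * ε                ∎)
      where
        instance
          _ = positive 0<B
          _ = ℚ.pos⇒nonZero B

    product-difference : ∀ x y z w → x * y - z * w ≡ x * (y - w) + w * (x - z)
    product-difference =
      solve 4 (λ x y z w → x :* y :- z :* w := x :* (y :- w) :+ w :* (x :- z)) refl
      where open +-*-Solver

    product-< : ∀ {x y B η} → 0ℚ ≤ y → 0ℚ < B → x ≤ B → y < η → x * y < B * η
    product-< {x} {y} {B} {η} 0≤y 0<B x≤B y<η = begin-strict
      x * y ≤⟨ ℚ.*-monoʳ-≤-nonNeg y {{nonNegative 0≤y}} x≤B ⟩
      B * y <⟨ ℚ.*-monoʳ-<-pos B {{positive 0<B}} y<η ⟩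
      B * η ∎

    product-close : ∀ {x y z w B C η θ ε} → 0ℚ < B → 0ℚ < C → B * η ≡ ½ * ε → C * θ ≡ ½ * ε →
                    ∥ x ∥ ≤ B → ∥ w ∥ ≤ C → ∥ x - z ∥ < θ → ∥ y - w ∥ < η →
                    ∥ x * y - z * w ∥ < ε
    product-close {x} {y} {z} {w} {B} {C} {η} {θ} {ε} 0<B 0<C Bη Cθ x≤B w≤C x-z y-w = begin-strict
      ∥ x * y - z * w ∥                     ≡⟨ cong ∥_∥ (product-difference x y z w) ⟩
      ∥ x * (y - w) + w * (x - z) ∥         ≤⟨ ∥+∥ (x * (y - w)) (w * (x - z)) ⟩
      ∥ x * (y - w) ∥ + ∥ w * (x - z) ∥     ≡⟨ cong₂ _+_ (∥*∥ x (y - w)) (∥*∥ w (x - z)) ⟩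
      ∥ x ∥ * ∥ y - w ∥ + ∥ w ∥ * ∥ x - z ∥ <⟨ ℚ.+-mono-< (product-< 0≤∥ y - w ∥ 0<B x≤B y-w)
                                                         (product-< 0≤∥ x - z ∥ 0<C w≤C x-z) ⟩
      B * η + C * θ                         ≡⟨ cong₂ _+_ Bη Cθ ⟩
      ½ * ε + ½ * ε                         ≡⟨ half+half ε ⟩
      ε                                     ∎

  *-cauchy : ∀ {a b} → IsCauchy A a → IsCauchy A b → IsCauchy A (λ n → a n * b n)
  *-cauchy {a} {b} ca cb ε 0<ε =
    let K₁ , B , 0<B , a≤B = eventually-bounded {a} ca
        K₂ , C , 0<C , b≤C = eventually-bounded {b} cb
        η , 0<η , Bη       = quotient 0<B 0<ε
        θ , 0<θ , Cθ       = quotient 0<C 0<ε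
        K₃ , close-b       = cb η 0<η
        K₄ , close-a       = ca θ 0<θ
    in (K₁ ℕ.⊔ K₂) ℕ.⊔ (K₃ ℕ.⊔ K₄) , λ m n K≤m K≤n →
      product-close {a m} {b m} {a n} {b n} 0<B 0<C Bη Cθ
        (a≤B m (ℕ.m⊔n≤o⇒m≤o K₁ K₂ (ℕ.m⊔n≤o⇒m≤o _ _ K≤m)))
        (b≤C n (ℕ.m⊔n≤o⇒n≤o K₁ K₂ (ℕ.m⊔n≤o⇒m≤o _ _ K≤n)))
        (close-a m n (ℕ.m⊔n≤o⇒n≤o K₃ K₄ (ℕ.m⊔n≤o⇒n≤o (K₁ ℕ.⊔ K₂) _ K≤m))
                     (ℕ.m⊔n≤o⇒n≤o K₃ K₄ (ℕ.m⊔n≤o⇒n≤o (K₁ ℕ.⊔ K₂) _ K≤n)))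
        (close-b m n (ℕ.m⊔n≤o⇒m≤o K₃ K₄ (ℕ.m⊔n≤o⇒n≤o (K₁ ℕ.⊔ K₂) _ K≤m))
                     (ℕ.m⊔n≤o⇒m≤o K₃ K₄ (ℕ.m⊔n≤o⇒n≤o (K₁ ℕ.⊔ K₂) _ K≤n)))

usual : AbsoluteValue
usual = record
  { ∥_∥     = ℚ.∣_∣
  ; 0≤∥_∥   = ℚ.0≤∣p∣
  ; ∥0∥≡0   = refl
  ; ∥∥≡0⇒≡0 = ℚ.∣p∣≡0⇒p≡0
  ; ∥*∥     = ℚ.∣p*q∣≡∣p∣*∣q∣
  ; ∥+∥     = ℚ.∣p+q∣≤∣p∣+∣q∣
  }

ℝ : Set
ℝ = Completion usual

infix 4 _<ʳ_

_<ʳ_ : ℝ → ℝ → Set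
x <ʳ y = ∃[ δ ] (0ℚ < δ × (∃[ K ] (∀ n → K ℕ.≤ n → approx x n + δ ≤ approx y n)))

module CompletionOperations (A : AbsoluteValue) where
  open AbsoluteValue A using (∥_∥)
  open AbsoluteValueProperties A

  infix  4 _≈_ _⟶_
  infixl 6 _+ᶜ_ _-ᶜ_
  infixl 7 _*ᶜ_

  ι : ℚ → Completion A
  ι a = completed (λ _ → a) (const-cauchy a)

  _+ᶜ_ : Completion A → Completion A → Completion A
  x +ᶜ y = completed (λ n → approx x n + approx y n) (+-cauchy {approx x} {approx y} (cauchy x) (cauchy y))

  -ᶜ_ : Completion A → Completion A
  -ᶜ x = completed (λ n → - approx x n) (neg-cauchy {approx x} (cauchy x))

  _-ᶜ_ : Completion A → Completion A → Completion A
  x -ᶜ y = x +ᶜ (-ᶜ y)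

  _*ᶜ_ : Completion A → Completion A → Completion A
  x *ᶜ y = completed (λ n → approx x n * approx y n) (*-cauchy {approx x} {approx y} (cauchy x) (cauchy y))

  _≈_ : Completion A → Completion A → Set
  x ≈ y = ∀ (ε : ℚ) → 0ℚ < ε → ∃[ K ] (∀ n → K ℕ.≤ n → ∥ approx x n - approx y n ∥ < ε)

  rawSemiring : RawSemiring 0ℓ 0ℓ
  rawSemiring = record
    { Carrier = Completion A ; _≈_ = _≈_ ; _+_ = _+ᶜ_ ; _*_ = _*ᶜ_ ; 0# = ι 0ℚ ; 1# = ι 1ℚ }

  open RawSemiringDefs rawSemiring public using () renaming (_^_ to _^ᶜ_)

  -- The extension to the completion of the absolute value on ℚ.
  ∥_∥ᶜ : Completion A → ℝ
  ∥ x ∥ᶜ = completed (λ n → ∥ approx x n ∥) λ ε 0<ε →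
    proj₁ (cauchy x ε 0<ε) , λ m n K≤m K≤n →
      ℚ.≤-<-trans (reverse-triangle (approx x m) (approx x n)) (proj₂ (cauchy x ε 0<ε) m n K≤m K≤n)

  -- Rational ε suffice, as every positive real exceeds a positive rational.
  _⟶_ : (ℕ → Completion A) → Completion A → Set
  s ⟶ l = ∀ (ε : ℚ) → 0ℚ < ε → ∃[ K ] (∀ k → K ℕ.≤ k → ∥ s k -ᶜ l ∥ᶜ <ʳ ιʳ ε)
    where
      ιʳ : ℚ → ℝ
      ιʳ a = completed (λ _ → a) (AbsoluteValueProperties.const-cauchy usual a)

  partialSum : (ℕ → Completion A) → ℕ → Completion A
  partialSum t zero    = ι 0ℚ
  partialSum t (suc k) = partialSum t k +ᶜ t k

  SeriesConverges : (ℕ → Completion A) → Set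
  SeriesConverges t = ∃[ l ] partialSum t ⟶ l

module Padic (p : ℕ) (pp : Prime p) where
  private instance
    p≢0 : ℕ.NonZero p
    p≢0 = prime⇒nonZero pp

  1<p : 1 ℕ.< p
  1<p = ℕ.nonTrivial⇒n>1 p {{prime⇒nonTrivial pp}}

  greatest : ℕ → ℕ → ℕ
  greatest n zero    = zero
  greatest n (suc k) = if does (p ℕ.^ suc k ∣? n) then suc k else greatest n k

  -- The exponent of p in n ≠ 0, as the greatest k ≤ n with p ^ k ∣ n; the bound k ≤ n
  -- is harmless because k < p ^ k, see ord-greatest.
  ord : ℕ → ℕ
  ord n = greatest n n

  p^_/p^_ : ℕ → ℕ → ℚ
  p^ j /p^ k = + (p ℕ.^ j) / (p ℕ.^ k)
    where instance _ = ℕ.m^n≢0 p k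

  -- With v the valuation, v (n / d) = ord n - ord d for nonzero n, so that
  -- p ^ (- v) = p ^ ord d / p ^ ord n.
  fracAbs : ℕ → ℕ → ℚ
  fracAbs zero      d = 0ℚ
  fracAbs n@(suc _) d = p^ ord d /p^ ord n

  ∣_∣ₚ : ℚ → ℚ
  ∣ a ∣ₚ = fracAbs (abs (↥ a)) (↧ₙ a)

  private
    greatest-∣ : ∀ n k → p ℕ.^ greatest n k ∣ n
    greatest-∣ n zero = 1∣ n
    greatest-∣ n (suc k) with p ℕ.^ suc k ∣? n
    ... | yes d = d
    ... | no  _ = greatest-∣ n k

    greatest-max : ∀ n k j → j ℕ.≤ k → p ℕ.^ j ∣ n → j ℕ.≤ greatest n k
    greatest-max n zero j j≤0 _ = j≤0
    greatest-max n (suc k) j j≤k d with p ℕ.^ suc k ∣? n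
    ... | yes _ = j≤k
    ... | no ¬d with ℕ.m≤n⇒m<n∨m≡n j≤k
    ...   | inj₁ (ℕ.s≤s j≤k′) = greatest-max n k j j≤k′ d
    ...   | inj₂ refl = contradiction d ¬d

    k<p^k : ∀ k → k ℕ.< p ℕ.^ k
    k<p^k zero    = ℕ.≤-refl
    k<p^k (suc k) = ℕ.≤-<-trans (k<p^k k) (ℕ.^-monoʳ-< p 1<p (ℕ.n<1+n k))

  ord-∣ : ∀ n → p ℕ.^ ord n ∣ n
  ord-∣ n = greatest-∣ n n

  ord-greatest : ∀ n .{{_ : ℕ.NonZero n}} k → p ℕ.^ k ∣ n → k ℕ.≤ ord n
  ord-greatest n k d =
    greatest-max n n k (ℕ.≤-trans (ℕ.<⇒≤ (k<p^k k)) (∣⇒≤ d)) d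

  ord-cofactor : ∀ n .{{_ : ℕ.NonZero n}} → ∃[ m ] (n ≡ p ℕ.^ ord n ℕ.* m × ¬ (p ∣ m))
  ord-cofactor n with ord-∣ n
  ... | divides m eq = m , eq′ , λ { (divides r refl) → ℕ.1+n≰n
          (ord-greatest n (suc (ord n)) (divides r (trans eq (ℕ.*-assoc r p (p ℕ.^ ord n))))) }
    where eq′ = trans eq (ℕ.*-comm m _)

  p^-mono-∣ : ∀ {j k} → j ℕ.≤ k → p ℕ.^ j ∣ p ℕ.^ k
  p^-mono-∣ {j} {k} j≤k = divides (p ℕ.^ (k ℕ.∸ j))
    (trans (cong (p ℕ.^_) (sym (ℕ.m∸n+n≡m j≤k))) (ℕ.^-distribˡ-+-* p (k ℕ.∸ j) j))

  ord-* : ∀ m n .{{_ : ℕ.NonZero m}} .{{_ : ℕ.NonZero n}} → ord (m ℕ.* n) ≡ ord m ℕ.+ ord n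
  ord-* m n with ord-cofactor m | ord-cofactor n
  ... | m′ , m≡ , p∤m′ | n′ , n≡ , p∤n′ = ℕ.≤-antisym (ℕ.≮⇒≥ upper) lower
    where
      instance _ = ℕ.m*n≢0 m n
      p^a = p ℕ.^ ord m
      p^b = p ℕ.^ ord n
      p^[a+b] = p ℕ.^ (ord m ℕ.+ ord n)
      lower : ord m ℕ.+ ord n ℕ.≤ ord (m ℕ.* n)
      lower = ord-greatest (m ℕ.* n) (ord m ℕ.+ ord n)
        (subst (_∣ m ℕ.* n) (sym (ℕ.^-distribˡ-+-* p (ord m) (ord n)))
          (*-pres-∣ (ord-∣ m) (ord-∣ n)))
      interchange : ∀ a b c d → (a ℕ.* b) ℕ.* (c ℕ.* d) ≡ (a ℕ.* c) ℕ.* (b ℕ.* d)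
      interchange = solveℕ-∀
      mn≡ : m ℕ.* n ≡ p^[a+b] ℕ.* (m′ ℕ.* n′)
      mn≡ = trans (cong₂ ℕ._*_ m≡ n≡) (trans (interchange p^a m′ p^b n′)
        (cong (ℕ._* (m′ ℕ.* n′)) (sym (ℕ.^-distribˡ-+-* p (ord m) (ord n)))))
      upper : ¬ (ord m ℕ.+ ord n ℕ.< ord (m ℕ.* n))
      upper h = [ p∤m′ , p∤n′ ]′ (euclidsLemma m′ n′ pp (*-cancelˡ-∣ p^[a+b] {{ℕ.m^n≢0 p (ord m ℕ.+ ord n)}}
        (subst₂ _∣_ (ℕ.*-comm p p^[a+b]) mn≡
          (∣-trans (p^-mono-∣ h) (ord-∣ (m ℕ.* n))))))

  /-≡ : ∀ a b c d .{{_ : ℕ.NonZero b}} .{{_ : ℕ.NonZero d}} →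
        a ℕ.* d ≡ c ℕ.* b → + a / b ≡ + c / d
  /-≡ a (suc b) c (suc d) eq = ℚ.fromℚᵘ-cong {mkℚᵘ (+ a) b} {mkℚᵘ (+ c) d}
    (*≡* (trans (sym (ℤ.pos-* a (suc d))) (trans (cong +_ eq) (ℤ.pos-* c (suc b)))))

  /-≤ : ∀ a b c d .{{_ : ℕ.NonZero b}} .{{_ : ℕ.NonZero d}} →
        a ℕ.* d ℕ.≤ c ℕ.* b → + a / b ≤ + c / d
  /-≤ a (suc b) c (suc d) le = ℚ.toℚᵘ-cancel-≤ (begin
    toℚᵘ (+ a / suc b) ≃⟨ ℚ.toℚᵘ-fromℚᵘ (mkℚᵘ (+ a) b) ⟩
    mkℚᵘ (+ a) b       ≤⟨ *≤* (subst₂ ℤ._≤_ (ℤ.pos-* a (suc d)) (ℤ.pos-* c (suc b)) (ℤ.+≤+ le)) ⟩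
    mkℚᵘ (+ c) d       ≃⟨ ℚ.toℚᵘ-fromℚᵘ (mkℚᵘ (+ c) d) ⟨
    toℚᵘ (+ c / suc d) ∎)
    where open ℚᵘ.≤-Reasoning

  /-* : ∀ a b c d .{{_ : ℕ.NonZero b}} .{{_ : ℕ.NonZero d}} .{{_ : ℕ.NonZero (b ℕ.* d)}} →
        + (a ℕ.* c) / (b ℕ.* d) ≡ (+ a / b) * (+ c / d)
  /-* a b@(suc b-1) c d@(suc d-1) = ℚ.toℚᵘ-injective (begin
    toℚᵘ (+ (a ℕ.* c) / (b ℕ.* d))
      ≈⟨ ℚ.toℚᵘ-fromℚᵘ (mkℚᵘ (+ (a ℕ.* c)) (d-1 ℕ.+ b-1 ℕ.* d)) ⟩
    mkℚᵘ (+ (a ℕ.* c)) (d-1 ℕ.+ b-1 ℕ.* d)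
      ≈⟨ *≡* (cong (ℤ._* + (b ℕ.* d)) (ℤ.pos-* a c)) ⟩
    mkℚᵘ (+ a) b-1 ℚᵘ.* mkℚᵘ (+ c) d-1
      ≈⟨ ℚᵘ.*-cong (ℚ.toℚᵘ-fromℚᵘ (mkℚᵘ (+ a) b-1)) (ℚ.toℚᵘ-fromℚᵘ (mkℚᵘ (+ c) d-1)) ⟨
    toℚᵘ (+ a / b) ℚᵘ.* toℚᵘ (+ c / d)
      ≈⟨ ℚ.toℚᵘ-homo-* (+ a / b) (+ c / d) ⟨
    toℚᵘ ((+ a / b) * (+ c / d)) ∎)
    where open ℚᵘ.≃-Reasoning

  ratio-cong : ∀ i j k l → i ℕ.+ l ≡ k ℕ.+ j → p^ i /p^ j ≡ p^ k /p^ l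
  ratio-cong i j k l eq = /-≡ (p ℕ.^ i) (p ℕ.^ j) (p ℕ.^ k) (p ℕ.^ l)
    {{ℕ.m^n≢0 p j}} {{ℕ.m^n≢0 p l}} (begin
      p ℕ.^ i ℕ.* p ℕ.^ l ≡⟨ ℕ.^-distribˡ-+-* p i l ⟨
      p ℕ.^ (i ℕ.+ l)     ≡⟨ cong (p ℕ.^_) eq ⟩
      p ℕ.^ (k ℕ.+ j)     ≡⟨ ℕ.^-distribˡ-+-* p k j ⟩
      p ℕ.^ k ℕ.* p ℕ.^ j ∎)
    where open ≡-Reasoning

  ratio-* : ∀ i j k l → p^ (i ℕ.+ k) /p^ (j ℕ.+ l) ≡ (p^ i /p^ j) * (p^ k /p^ l)
  ratio-* i j k l = trans
    (/-≡ (p ℕ.^ (i ℕ.+ k)) (p ℕ.^ (j ℕ.+ l)) (p ℕ.^ i ℕ.* p ℕ.^ k) (p ℕ.^ j ℕ.* p ℕ.^ l)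
      {{ℕ.m^n≢0 p (j ℕ.+ l)}} {{p^j*p^l≢0}}
      (cong₂ ℕ._*_ (ℕ.^-distribˡ-+-* p i k) (sym (ℕ.^-distribˡ-+-* p j l))))
    (/-* (p ℕ.^ i) (p ℕ.^ j) (p ℕ.^ k) (p ℕ.^ l)
      {{ℕ.m^n≢0 p j}} {{ℕ.m^n≢0 p l}} {{p^j*p^l≢0}})
    where
      p^j*p^l≢0 : ℕ.NonZero (p ℕ.^ j ℕ.* p ℕ.^ l)
      p^j*p^l≢0 = ℕ.m*n≢0 (p ℕ.^ j) (p ℕ.^ l) {{ℕ.m^n≢0 p j}} {{ℕ.m^n≢0 p l}}

  ratio-antimono : ∀ i j k → k ℕ.≤ j → p^ i /p^ j ≤ p^ i /p^ k
  ratio-antimono i j k k≤j = /-≤ (p ℕ.^ i) (p ℕ.^ j) (p ℕ.^ i) (p ℕ.^ k)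
    {{ℕ.m^n≢0 p j}} {{ℕ.m^n≢0 p k}} (ℕ.*-monoʳ-≤ (p ℕ.^ i) (ℕ.^-monoʳ-≤ p k≤j))

  ratio-positive : ∀ i j → Positive (p^ i /p^ j)
  ratio-positive i j = ℚ.normalize-pos (p ℕ.^ i) (p ℕ.^ j) {{ℕ.m^n≢0 p j}} {{ℕ.m^n≢0 p i}}

  instance
    ↧ₙ≢0 : ∀ {a} → ℕ.NonZero (↧ₙ a)
    ↧ₙ≢0 {a@record{}} = _

  fracAbs-nonNeg : ∀ n d → 0ℚ ≤ fracAbs n d
  fracAbs-nonNeg zero      d = ℚ.≤-refl
  fracAbs-nonNeg n@(suc _) d = ℚ.<⇒≤ (ℚ.positive⁻¹ (fracAbs n d) {{ratio-positive (ord d) (ord n)}})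

  fracAbs≢0 : ∀ n .{{_ : ℕ.NonZero n}} d → fracAbs n d ≢ 0ℚ
  fracAbs≢0 n@(suc _) d eq = ℚ.<⇒≢ (ℚ.positive⁻¹ (fracAbs n d)
    {{ratio-positive (ord d) (ord n)}}) (sym eq)

  fracAbs-* : ∀ m n c d .{{_ : ℕ.NonZero c}} .{{_ : ℕ.NonZero d}} →
              fracAbs (m ℕ.* n) (c ℕ.* d) ≡ fracAbs m c * fracAbs n d
  fracAbs-* zero      n         c d = sym (ℚ.*-zeroˡ (fracAbs n d))
  fracAbs-* m@(suc _) zero      c d =
    trans (cong (λ k → fracAbs k (c ℕ.* d)) (ℕ.*-zeroʳ m)) (sym (ℚ.*-zeroʳ (fracAbs m c)))
  fracAbs-* m@(suc _) n@(suc _) c d =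
    trans (cong₂ p^_/p^_ (ord-* c d) (ord-* m n)) (ratio-* (ord c) (ord m) (ord d) (ord n))

  fracAbs-cong : ∀ m c n d .{{_ : ℕ.NonZero c}} .{{_ : ℕ.NonZero d}} →
                 m ℕ.* d ≡ n ℕ.* c → fracAbs m c ≡ fracAbs n d
  fracAbs-cong zero c zero d eq = refl
  fracAbs-cong zero c n@(suc _) d eq = contradiction (sym eq) (ℕ.≢-nonZero⁻¹ (n ℕ.* c) {{ℕ.m*n≢0 n c}})
  fracAbs-cong m@(suc _) c zero d eq = contradiction eq (ℕ.≢-nonZero⁻¹ (m ℕ.* d) {{ℕ.m*n≢0 m d}})
  fracAbs-cong m@(suc _) c n@(suc _) d eq =
    ratio-cong (ord c) (ord m) (ord d) (ord n) ord-eq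
    where
      open ≡-Reasoning
      ord-eq : ord c ℕ.+ ord n ≡ ord d ℕ.+ ord m
      ord-eq = begin
        ord c ℕ.+ ord n ≡⟨ ℕ.+-comm (ord c) (ord n) ⟩
        ord n ℕ.+ ord c ≡⟨ ord-* n c ⟨
        ord (n ℕ.* c)   ≡⟨ cong ord eq ⟨
        ord (m ℕ.* d)   ≡⟨ ord-* m d ⟩
        ord m ℕ.+ ord d ≡⟨ ℕ.+-comm (ord m) (ord d) ⟩
        ord d ℕ.+ ord m ∎

  fracAbs-antimono : ∀ m n .{{_ : ℕ.NonZero n}} d → p ℕ.^ ord n ∣ m → fracAbs m d ≤ fracAbs n d
  fracAbs-antimono zero      n d _ = fracAbs-nonNeg n d
  fracAbs-antimono m@(suc _) n@(suc _) d h =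
    ratio-antimono (ord d) (ord m) (ord n) (ord-greatest m (ord n) h)

  p^-∣ : ∀ {j n} → j ℕ.≤ ord n → p ℕ.^ j ∣ n
  p^-∣ {j} {n} j≤ = ∣-trans (p^-mono-∣ j≤) (ord-∣ n)

  fracAbs-+ : ∀ i j d → fracAbs (abs (i ℤ.+ j)) d ≤ fracAbs (abs i) d + fracAbs (abs j) d
  fracAbs-+ i j d = by-cases i j (zero-or-not i) (zero-or-not j)
    where
      open ℚ.≤-Reasoning
      zero-or-not : ∀ i → i ≡ + 0 ⊎ ℕ.NonZero (abs i)
      zero-or-not (+ zero)    = inj₁ refl
      zero-or-not (+ suc _)   = inj₂ _
      zero-or-not (ℤ.-[1+ _ ]) = inj₂ _

      sum-∣ : ∀ k i j → k ∣ abs i → k ∣ abs j → k ∣ abs (i ℤ.+ j)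
      sum-∣ k i j k∣i k∣j = ℤ.∣⇒∣ᵤ {+ k} {i ℤ.+ j}
        (ℤ.∣m∣n⇒∣m+n (ℤ.∣ᵤ⇒∣ {+ k} {i} k∣i) (ℤ.∣ᵤ⇒∣ {+ k} {j} k∣j))

      ≤-left : ∀ a b → fracAbs a d ≤ fracAbs a d + fracAbs b d
      ≤-left a b = ℚ.≤-trans (ℚ.≤-reflexive (sym (ℚ.+-identityʳ _)))
                             (ℚ.+-monoʳ-≤ (fracAbs a d) (fracAbs-nonNeg b d))

      ≤-right : ∀ a b → fracAbs b d ≤ fracAbs a d + fracAbs b d
      ≤-right a b = ℚ.≤-trans (≤-left b a) (ℚ.≤-reflexive (ℚ.+-comm (fracAbs b d) (fracAbs a d)))

      by-cases : ∀ i j → i ≡ + 0 ⊎ ℕ.NonZero (abs i) → j ≡ + 0 ⊎ ℕ.NonZero (abs j) →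
                 fracAbs (abs (i ℤ.+ j)) d ≤ fracAbs (abs i) d + fracAbs (abs j) d
      by-cases i j (inj₁ refl) _ = ℚ.≤-trans
        (ℚ.≤-reflexive (cong (λ k → fracAbs (abs k) d) (ℤ.+-identityˡ j))) (≤-right 0 (abs j))
      by-cases i j (inj₂ _) (inj₁ refl) = ℚ.≤-trans
        (ℚ.≤-reflexive (cong (λ k → fracAbs (abs k) d) (ℤ.+-identityʳ i))) (≤-left (abs i) 0)
      by-cases i j (inj₂ i≢0) (inj₂ j≢0) with ℕ.≤-total (ord (abs i)) (ord (abs j))
      ... | inj₁ le = ℚ.≤-trans
        (fracAbs-antimono (abs (i ℤ.+ j)) (abs i) {{i≢0}} d
          (sum-∣ (p ℕ.^ ord (abs i)) i j (ord-∣ (abs i)) (p^-∣ {n = abs j} le)))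
        (≤-left (abs i) (abs j))
      ... | inj₂ le = ℚ.≤-trans
        (fracAbs-antimono (abs (i ℤ.+ j)) (abs j) {{j≢0}} d
          (sum-∣ (p ℕ.^ ord (abs j)) i j (p^-∣ {n = abs i} le) (ord-∣ (abs j))))
        (≤-right (abs i) (abs j))

  ∣∣ₚ-of-≃ : ∀ a i d → toℚᵘ a ℚᵘ.≃ mkℚᵘ i d → ∣ a ∣ₚ ≡ fracAbs (abs i) (suc d)
  ∣∣ₚ-of-≃ a@record{} i d (*≡* eq) = fracAbs-cong (abs (↥ a)) (↧ₙ a) (abs i) (suc d)
    (trans (sym (ℤ.abs-* (↥ a) (+ suc d))) (trans (cong abs eq) (ℤ.abs-* i (+ ↧ₙ a))))

  ∣∣ₚ≡0 : ∀ a → ∣ a ∣ₚ ≡ 0ℚ → a ≡ 0ℚ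
  ∣∣ₚ≡0 a eq with abs (↥ a) in abs-eq
  ... | zero  = ℚ.↥p≡0⇒p≡0 a (ℤ.∣i∣≡0⇒i≡0 abs-eq)
  ... | suc n = contradiction eq (fracAbs≢0 (suc n) (↧ₙ a))

  ∣*∣ₚ : ∀ a b → ∣ a * b ∣ₚ ≡ ∣ a ∣ₚ * ∣ b ∣ₚ
  ∣*∣ₚ a@record{} b@record{} = trans
    (∣∣ₚ-of-≃ (a * b) _ _ (ℚ.toℚᵘ-homo-* a b))
    (trans (cong (λ k → fracAbs k (↧ₙ a ℕ.* ↧ₙ b)) (ℤ.abs-* (↥ a) (↥ b)))
           (fracAbs-* (abs (↥ a)) (abs (↥ b)) (↧ₙ a) (↧ₙ b)))

  rescale : ∀ i c d .{{_ : ℕ.NonZero c}} .{{_ : ℕ.NonZero d}} .{{_ : ℕ.NonZero (c ℕ.* d)}} →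
            fracAbs (abs (i ℤ.* + d)) (c ℕ.* d) ≡ fracAbs (abs i) c
  rescale i c d = fracAbs-cong (abs (i ℤ.* + d)) (c ℕ.* d) (abs i) c
    (trans (cong (ℕ._* c) (ℤ.abs-* i (+ d))) (reorder (abs i) d c))
    where
      reorder : ∀ a b c → (a ℕ.* b) ℕ.* c ≡ a ℕ.* (c ℕ.* b)
      reorder = solveℕ-∀

  ∣+∣ₚ : ∀ a b → ∣ a + b ∣ₚ ≤ ∣ a ∣ₚ + ∣ b ∣ₚ
  ∣+∣ₚ a@record{} b@record{} = begin
    ∣ a + b ∣ₚ
      ≡⟨ ∣∣ₚ-of-≃ (a + b) _ _ (ℚ.toℚᵘ-homo-+ a b) ⟩
    fracAbs (abs (↥ a ℤ.* + ↧ₙ b ℤ.+ ↥ b ℤ.* + ↧ₙ a)) (↧ₙ a ℕ.* ↧ₙ b)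
      ≤⟨ fracAbs-+ (↥ a ℤ.* + ↧ₙ b) (↥ b ℤ.* + ↧ₙ a) (↧ₙ a ℕ.* ↧ₙ b) ⟩
    fracAbs (abs (↥ a ℤ.* + ↧ₙ b)) (↧ₙ a ℕ.* ↧ₙ b) + fracAbs (abs (↥ b ℤ.* + ↧ₙ a)) (↧ₙ a ℕ.* ↧ₙ b)
      ≡⟨ cong₂ _+_ (rescale (↥ a) (↧ₙ a) (↧ₙ b))
           (trans (cong (fracAbs (abs (↥ b ℤ.* + ↧ₙ a))) (ℕ.*-comm (↧ₙ a) (↧ₙ b)))
                  (rescale (↥ b) (↧ₙ b) (↧ₙ a))) ⟩
    ∣ a ∣ₚ + ∣ b ∣ₚ ∎
    where open ℚ.≤-Reasoning

  padic : AbsoluteValue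
  padic = record
    { ∥_∥     = ∣_∣ₚ
    ; 0≤∥_∥   = λ a → fracAbs-nonNeg (abs (↥ a)) (↧ₙ a)
    ; ∥0∥≡0   = refl
    ; ∥∥≡0⇒≡0 = ∣∣ₚ≡0
    ; ∥*∥     = ∣*∣ₚ
    ; ∥+∥     = ∣+∣ₚ
    }

padic : (p : ℕ) → Prime p → AbsoluteValue
padic = Padic.padic

ℚₚ : (p : ℕ) → Prime p → Set
ℚₚ p pp = Completion (padic p pp)

open RawSemiringDefs ℚ.+-*-rawSemiring using () renaming (_^_ to _^ℚ_)

fromℕ : ℕ → ℚ
fromℕ n = + n / 1

φ-coefficient : (ε q : ℚ) .{{_ : Positive q}} (γ δ N n : ℕ) → ℚ
φ-coefficient ε q γ δ N n =
  ε ^ℚ n * (fromℕ ((m !) ℕ.^ m) ÷ (q + fromℕ ((m !) ℕ.^ (N ℕ.* m)))) * (+ 1 / (m !))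
  where
    m = γ ℕ.* n ℕ.+ δ
    instance
      _ = m ℕ.!≢0
      q+[m!]^Nm>0 : Positive (q + fromℕ ((m !) ℕ.^ (N ℕ.* m)))
      q+[m!]^Nm>0 = ℚ.pos+nonNeg⇒pos q (fromℕ ((m !) ℕ.^ (N ℕ.* m)))
        {{ℚ.normalize-nonNeg ((m !) ℕ.^ (N ℕ.* m)) 1}}
      _ = ℚ.pos⇒nonZero (q + fromℕ ((m !) ℕ.^ (N ℕ.* m)))

module _ (A : AbsoluteValue) where
  open CompletionOperations A

  φ-term : (ε q : ℚ) .{{_ : Positive q}} (γ δ N : ℕ) → Completion A → ℕ → Completion A
  φ-term ε q γ δ N x n = ι (φ-coefficient ε q γ δ N n) *ᶜ x ^ᶜ (γ ℕ.* n ℕ.+ δ)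

  φ-ConvergesAt : (ε q : ℚ) .{{_ : Positive q}} (γ δ N : ℕ) → Completion A → Set
  φ-ConvergesAt ε q γ δ N x = SeriesConverges (φ-term ε q γ δ N x)

{-# OPTIONS --safe #-}
-- Write m = γn + δ and f = m!, and let |·| be any of the absolute values in question.
-- The coefficient c satisfies |c| |q + f^(Nm)| |f| = |f|^m.
-- Over ℝ the factor q + f^(Nm) dominates f^m, so |c| f ≤ 1 and the series is dominated
-- by an exponential series.  Over ℚₚ the factorials tend to 0, so |q + f^(Nm)| is
-- eventually at least |q|/2, and |c| |x|^m ≤ 2 (|f| |x|)^(m-1) |x| / |q| is
-- eventually at most a constant times 2^(-m), because |f| |x| ≤ 1/2.
-- In both cases the terms have a geometric majorant valid for all late approximants
-- of x at once, and the diagonal of the approximants of the partial sums is the sum.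
module Submission where

open import Defs
open import Algebra.Bundles using (module CommutativeRing)
import Algebra.Properties.CommutativeSemigroup as CommutativeSemigroup
import Algebra.Properties.CommutativeSemiring.Exp as Exp
open import Data.Integer.Base as ℤ using (+_; -[1+_]) renaming (∣_∣ to abs)
import Data.Integer.Properties as ℤ
open import Data.Nat.Base as ℕ using (ℕ; zero; suc; NonZero; _!)
import Data.Nat.Properties as ℕ
open import Data.Nat.Combinatorics using (k![n∸k]!∣n!)
open import Data.Nat.Coprimality as Coprime using (Coprime; 1-coprimeTo)
open import Data.Nat.Divisibility using (_∣_; ∣-trans; ∣⇒≤; *-pres-∣; 1∣_; m∣m*n; m≤n⇒m!∣n!)
open import Data.Nat.Primality using (Prime; prime[2]; prime⇒nonZero)
open import Data.Product.Base using (∃-syntax; _×_; _,_; proj₁; proj₂)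
open import Data.Rational.Base as ℚ
  using (ℚ; 0ℚ; 1ℚ; ½; _+_; _-_; -_; _*_; 1/_; _/_; _<_; _≤_; ↥_; ↧ₙ_; *≤*; *<*; mkℚ;
         Positive; positive; nonNegative)
import Data.Rational.Properties as ℚ
open import Data.Rational.Solver using (module +-*-Solver)
open import Data.Rational.Unnormalised.Base using (mkℚᵘ)
open import Data.Sum.Base using (_⊎_; inj₁; inj₂)
open import Relation.Binary.PropositionalEquality
open import Relation.Nullary using (yes; no; contradiction)

open CommutativeSemigroup ℕ.*-commutativeSemigroup using (x∙yz≈y∙xz)
open Exp (CommutativeRing.commutativeSemiring ℚ.+-*-commutativeRing)
  using (_^_; ^-distrib-*)
open ℚ.≤-Reasoning
-- These rules for fractions do not involve the prime.
open Padic 2 prime[2] using (/-≡; /-≤; /-*)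

-- Order and powers in the rationals.

*-mono-≤ : ∀ {a b c d} → 0ℚ ≤ c → 0ℚ ≤ b → a ≤ b → c ≤ d → a * c ≤ b * d
*-mono-≤ {a} {b} {c} {d} 0≤c 0≤b a≤b c≤d = begin
  a * c ≤⟨ ℚ.*-monoʳ-≤-nonNeg c {{nonNegative 0≤c}} a≤b ⟩
  b * c ≤⟨ ℚ.*-monoˡ-≤-nonNeg b {{nonNegative 0≤b}} c≤d ⟩
  b * d ∎

*-nonneg : ∀ {a b} → 0ℚ ≤ a → 0ℚ ≤ b → 0ℚ ≤ a * b
*-nonneg {a} {b} 0≤a 0≤b = ℚ.nonNegative⁻¹ (a * b)
  {{ℚ.nonNeg*nonNeg⇒nonNeg a {{nonNegative 0≤a}} b {{nonNegative 0≤b}}}}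

*-positive : ∀ {a b} → 0ℚ < a → 0ℚ < b → 0ℚ < a * b
*-positive {a} {b} 0<a 0<b = ℚ.positive⁻¹ (a * b)
  {{ℚ.pos*pos⇒pos a {{positive 0<a}} b {{positive 0<b}}}}

1/-positive : ∀ a .{{_ : Positive a}} → 0ℚ < (1/ a) {{ℚ.pos⇒nonZero a}}
1/-positive a = ℚ.positive⁻¹ ((1/ a) {{ℚ.pos⇒nonZero a}}) {{ℚ.1/pos⇒pos a}}

pos⇒≢0 : ∀ a .{{_ : Positive a}} → a ≢ 0ℚ
pos⇒≢0 a a≡0 = ℚ.<⇒≢ (ℚ.positive⁻¹ a) (sym a≡0)

*-cancelʳ-≡-pos : ∀ {a b} r .{{_ : Positive r}} → a * r ≡ b * r → a ≡ b
*-cancelʳ-≡-pos r eq = ℚ.≤-antisym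
  (ℚ.*-cancelʳ-≤-pos r (ℚ.≤-reflexive eq))
  (ℚ.*-cancelʳ-≤-pos r (ℚ.≤-reflexive (sym eq)))

0≤½ : 0ℚ ≤ ½
0≤½ = ℚ.nonNegative⁻¹ ½

0<1 : 0ℚ < 1ℚ
0<1 = ℚ.positive⁻¹ 1ℚ

1^n≡1 : ∀ n → 1ℚ ^ n ≡ 1ℚ
1^n≡1 zero    = refl
1^n≡1 (suc n) = trans (ℚ.*-identityˡ (1ℚ ^ n)) (1^n≡1 n)

^-nonneg : ∀ {x} → 0ℚ ≤ x → ∀ n → 0ℚ ≤ x ^ n
^-nonneg 0≤x zero    = ℚ.<⇒≤ 0<1
^-nonneg 0≤x (suc n) = *-nonneg 0≤x (^-nonneg 0≤x n)

^-positive : ∀ {x} → 0ℚ < x → ∀ n → 0ℚ < x ^ n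
^-positive 0<x zero    = 0<1
^-positive 0<x (suc n) = *-positive 0<x (^-positive 0<x n)

^-mono-≤ : ∀ {x y} → 0ℚ ≤ x → x ≤ y → ∀ n → x ^ n ≤ y ^ n
^-mono-≤ 0≤x x≤y zero    = ℚ.≤-refl
^-mono-≤ 0≤x x≤y (suc n) =
  *-mono-≤ (^-nonneg 0≤x n) (ℚ.≤-trans 0≤x x≤y) x≤y (^-mono-≤ 0≤x x≤y n)

^-antitone : ∀ {x} → 0ℚ ≤ x → x ≤ 1ℚ → ∀ {m n} → m ℕ.≤ n → x ^ n ≤ x ^ m
^-antitone 0≤x x≤1 {n = n} ℕ.z≤n =
  ℚ.≤-trans (^-mono-≤ 0≤x x≤1 n) (ℚ.≤-reflexive (1^n≡1 n))
^-antitone {x} 0≤x x≤1 (ℕ.s≤s m≤n) =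
  ℚ.*-monoˡ-≤-nonNeg x {{nonNegative 0≤x}} (^-antitone 0≤x x≤1 m≤n)

½^-antitone : ∀ {m n} → m ℕ.≤ n → ½ ^ n ≤ ½ ^ m
½^-antitone = ^-antitone 0≤½ (*≤* (ℤ.+≤+ (ℕ.s≤s ℕ.z≤n)))

-- Natural numbers among the rationals, and null geometric sequences.

fromℕ-* : ∀ a b → fromℕ (a ℕ.* b) ≡ fromℕ a * fromℕ b
fromℕ-* a b = /-* a 1 b 1

fromℕ-^ : ∀ a n → fromℕ (a ℕ.^ n) ≡ fromℕ a ^ n
fromℕ-^ a zero    = refl
fromℕ-^ a (suc n) = trans (fromℕ-* a (a ℕ.^ n)) (cong (fromℕ a *_) (fromℕ-^ a n))

fromℕ-mono-≤ : ∀ {a b} → a ℕ.≤ b → fromℕ a ≤ fromℕ b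
fromℕ-mono-≤ {a} {b} a≤b = /-≤ a 1 b 1 (ℕ.*-monoˡ-≤ 1 a≤b)

fromℕ-mono-< : ∀ {a b} → a ℕ.< b → fromℕ a < fromℕ b
fromℕ-mono-< {a} {b} a<b = subst₂ _<_ (sym (fromℕ≡ a)) (sym (fromℕ≡ b))
  (*<* (ℤ.*-monoʳ-<-pos (+ 1) (ℤ.+<+ a<b)))
  where
    n⊥1 : ∀ n → Coprime n 1
    n⊥1 n = Coprime.sym (1-coprimeTo n)
    fromℕ≡ : ∀ n → fromℕ n ≡ mkℚ (+ n) 0 (n⊥1 n)
    fromℕ≡ n = ℚ.normalize-coprime (n⊥1 n)

fromℕ-nonneg : ∀ n → 0ℚ ≤ fromℕ n
fromℕ-nonneg n = fromℕ-mono-≤ {0} {n} ℕ.z≤n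

fromℕ-positive : ∀ n .{{_ : NonZero n}} → Positive (fromℕ n)
fromℕ-positive n = ℚ.normalize-pos n 1

fromℕ-inverse : ∀ n .{{_ : NonZero n}} → fromℕ n * (+ 1 / n) ≡ 1ℚ
fromℕ-inverse n = trans (sym (/-* n 1 1 n))
  (/-≡ (n ℕ.* 1) (1 ℕ.* n) 1 1 (trans (ℕ.*-identityʳ (n ℕ.* 1))
    (trans (ℕ.*-comm n 1) (sym (ℕ.*-identityˡ (1 ℕ.* n))))))
  where instance _ = ℕ.m*n≢0 1 n

archimedean : ∀ a → ∃[ n ] a ≤ fromℕ n
archimedean a@(mkℚ (+ n) d-1 _) = n , (begin
  a              ≡⟨ ℚ.↥p/↧p≡p a ⟨
  + n / suc d-1  ≤⟨ /-≤ n (suc d-1) n 1 (ℕ.*-monoʳ-≤ n (ℕ.s≤s ℕ.z≤n)) ⟩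
  fromℕ n        ∎)
archimedean a@(mkℚ -[1+ _ ] _ _) = 0 , ℚ.<⇒≤ (ℚ.negative⁻¹ a)

½^n*2^n≡1 : ∀ n → ½ ^ n * fromℕ (2 ℕ.^ n) ≡ 1ℚ
½^n*2^n≡1 n = begin-equality
  ½ ^ n * fromℕ (2 ℕ.^ n) ≡⟨ cong (½ ^ n *_) (fromℕ-^ 2 n) ⟩
  ½ ^ n * fromℕ 2 ^ n     ≡⟨ ^-distrib-* ½ (fromℕ 2) n ⟨
  1ℚ ^ n                  ≡⟨ 1^n≡1 n ⟩
  1ℚ                      ∎

n<2^n : ∀ n → n ℕ.< 2 ℕ.^ n
n<2^n zero    = ℕ.≤-refl
n<2^n (suc n) = ℕ.≤-<-trans (n<2^n n) (ℕ.^-monoʳ-< 2 ℕ.≤-refl (ℕ.n<1+n n))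

½^n*n<1 : ∀ n → ½ ^ n * fromℕ n < 1ℚ
½^n*n<1 n = begin-strict
  ½ ^ n * fromℕ n         <⟨ ℚ.*-monoʳ-<-pos (½ ^ n) {{positive (^-positive (ℚ.positive⁻¹ ½) n)}}
                               (fromℕ-mono-< (n<2^n n)) ⟩
  ½ ^ n * fromℕ (2 ℕ.^ n) ≡⟨ ½^n*2^n≡1 n ⟩
  1ℚ                      ∎

-- As `½ ^ k * fromℕ k` stays below 1, any natural number K that is at least C / ε works. `C` may
-- have either sign.
geometric-null : ∀ C {ε} → 0ℚ < ε → ∃[ K ] (∀ k → K ℕ.≤ k → C * ½ ^ k < ε)
geometric-null C {ε} 0<ε with archimedean (C * (1/ ε) {{ℚ.pos⇒nonZero ε {{positive 0<ε}}}})
... | K , C/ε≤K = K , λ k K≤k → begin-strict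
  C * ½ ^ k                 ≡⟨ ℚ.*-identityʳ (C * ½ ^ k) ⟨
  C * ½ ^ k * 1ℚ            ≡⟨ cong (C * ½ ^ k *_) (ℚ.*-inverseˡ ε) ⟨
  C * ½ ^ k * (1/ ε * ε)    ≡⟨ solve 4 (λ c h e i → c :* h :* (i :* e) := h :* (c :* i) :* e)
                                 refl C (½ ^ k) ε (1/ ε) ⟩
  ½ ^ k * (C * 1/ ε) * ε    ≤⟨ ℚ.*-monoʳ-≤-nonNeg ε (ℚ.*-monoˡ-≤-nonNeg (½ ^ k)
                                 {{nonNegative (^-nonneg 0≤½ k)}}
                                 (ℚ.≤-trans C/ε≤K (fromℕ-mono-≤ K≤k))) ⟩
  ½ ^ k * fromℕ k * ε       <⟨ ℚ.*-monoˡ-<-pos ε (½^n*n<1 k) ⟩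
  1ℚ * ε                    ≡⟨ ℚ.*-identityˡ ε ⟩
  ε                         ∎
  where
    open +-*-Solver
    instance
      _ = positive 0<ε
      _ = ℚ.pos⇒nonNeg ε
      _ = ℚ.pos⇒nonZero ε

-- Convergence from a geometric majorant, for an arbitrary absolute value.

module _ (A : AbsoluteValue) where
  open AbsoluteValue A
  open AbsoluteValueProperties A
  open CompletionOperations A

  ∥∥-positive : ∀ a → a ≢ 0ℚ → Positive ∥ a ∥
  ∥∥-positive a a≢0 = ℚ.nonNeg∧nonZero⇒pos ∥ a ∥
    {{nonNegative 0≤∥ a ∥}} {{ℚ.≢-nonZero λ ∥a∥≡0 → a≢0 (∥∥≡0⇒≡0 a ∥a∥≡0)}}

  -- Multiplicativity makes `∥ 1ℚ ∥` its own square; being positive, it cancels.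
  ∥1∥≡1 : ∥ 1ℚ ∥ ≡ 1ℚ
  ∥1∥≡1 = *-cancelʳ-≡-pos ∥ 1ℚ ∥ {{∥∥-positive 1ℚ ℚ.1≢0}}
    (trans (sym (∥*∥ 1ℚ 1ℚ)) (sym (ℚ.*-identityˡ ∥ 1ℚ ∥)))

  ∥^∥ : ∀ x n → ∥ x ^ n ∥ ≡ ∥ x ∥ ^ n
  ∥^∥ x zero    = ∥1∥≡1
  ∥^∥ x (suc n) = trans (∥*∥ x (x ^ n)) (cong (λ a → ∥ x ∥ * a) (∥^∥ x n))

  ∥±1∥≡1 : ∀ {ε} → ε ≡ 1ℚ ⊎ ε ≡ - 1ℚ → ∥ ε ∥ ≡ 1ℚ
  ∥±1∥≡1 (inj₁ refl) = ∥1∥≡1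
  ∥±1∥≡1 (inj₂ refl) = trans (∥-a∥≡∥a∥ 1ℚ) ∥1∥≡1

  -- Products in the completion are formed approximant by approximant, so powers there reduce to
  -- powers of rationals.
  ∥approx-^∥ : ∀ x n i → ∥ approx (x ^ᶜ n) i ∥ ≡ ∥ approx x i ∥ ^ n
  ∥approx-^∥ x zero    i = ∥1∥≡1
  ∥approx-^∥ x (suc n) i = trans (∥*∥ (approx x i) (approx (x ^ᶜ n) i))
    (cong (λ a → ∥ approx x i ∥ * a) (∥approx-^∥ x n i))

  -- One threshold `K` serves both the index of the term and that of the approximant. Uniformity in
  -- `i` is what makes the diagonal a limit.
  module _ (t : ℕ → Completion A) (K : ℕ) {M : ℚ} (0≤M : 0ℚ ≤ M)
           (t-bound : ∀ n i → K ℕ.≤ n → K ℕ.≤ i → ∥ approx (t n) i ∥ ≤ M * ½ ^ n) where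
    private
      S : ℕ → ℕ → ℚ
      S k i = approx (partialSum t k) i

      -- The sum of the geometric series `M * ½ ^ n` over all n from k on.
      tail : ℕ → ℚ
      tail k = (M + M) * ½ ^ k

      tail-step : ∀ k → M * ½ ^ k + tail (suc k) ≡ tail k
      tail-step k = solve 2 (λ m h → m :* h :+ (m :+ m) :* (con ½ :* h) := (m :+ m) :* h)
        refl M (½ ^ k)
        where open +-*-Solver

      tail-nonneg : ∀ k → 0ℚ ≤ tail k
      tail-nonneg k = *-nonneg (ℚ.+-mono-≤ 0≤M 0≤M) (^-nonneg 0≤½ k)

      -- Induction on the length `j` of the block closes because the remaining tail is kept on the
      -- left: each new term is paid for by `tail-step`.
      block+tail : ∀ {i} → K ℕ.≤ i → ∀ j k → K ℕ.≤ k →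
                   ∥ S (j ℕ.+ k) i - S k i ∥ + tail (j ℕ.+ k) ≤ tail k
      block+tail {i} K≤i zero    k K≤k = begin
        ∥ S k i - S k i ∥ + tail k ≡⟨ cong (λ a → ∥ a ∥ + tail k) (ℚ.+-inverseʳ (S k i)) ⟩
        ∥ 0ℚ ∥ + tail k            ≡⟨ cong (_+ tail k) ∥0∥≡0 ⟩
        0ℚ + tail k                ≡⟨ ℚ.+-identityˡ (tail k) ⟩
        tail k                     ∎
      block+tail {i} K≤i (suc j) k K≤k = begin
        ∥ S n i + c - S k i ∥ + tail (suc n)
          ≡⟨ cong (λ a → ∥ a ∥ + tail (suc n))
               (solve 3 (λ x y z → x :+ y :- z := (x :- z) :+ y) refl (S n i) c (S k i)) ⟩
        ∥ S n i - S k i + c ∥ + tail (suc n)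
          ≤⟨ ℚ.+-monoˡ-≤ (tail (suc n)) (ℚ.≤-trans (∥+∥ (S n i - S k i) c)
               (ℚ.+-monoʳ-≤ ∥ S n i - S k i ∥ (t-bound n i (ℕ.≤-trans K≤k (ℕ.m≤n+m k j)) K≤i))) ⟩
        ∥ S n i - S k i ∥ + M * ½ ^ n + tail (suc n)
          ≡⟨ ℚ.+-assoc ∥ S n i - S k i ∥ (M * ½ ^ n) (tail (suc n)) ⟩
        ∥ S n i - S k i ∥ + (M * ½ ^ n + tail (suc n))
          ≡⟨ cong (λ a → ∥ S n i - S k i ∥ + a) (tail-step n) ⟩
        ∥ S n i - S k i ∥ + tail n
          ≤⟨ block+tail K≤i j k K≤k ⟩
        tail k ∎
        where
          open +-*-Solver
          n = j ℕ.+ k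
          c = approx (t n) i

      block-≤ : ∀ {i j k} → K ℕ.≤ i → K ℕ.≤ k → k ℕ.≤ j → ∥ S j i - S k i ∥ ≤ tail k
      block-≤ {i} {j} {k} K≤i K≤k k≤j = subst (λ n → ∥ S n i - S k i ∥ ≤ tail k) (ℕ.m∸n+n≡m k≤j)
        (begin
          ∥ S n i - S k i ∥          ≡⟨ ℚ.+-identityʳ ∥ S n i - S k i ∥ ⟨
          ∥ S n i - S k i ∥ + 0ℚ     ≤⟨ ℚ.+-monoʳ-≤ ∥ S n i - S k i ∥ (tail-nonneg n) ⟩
          ∥ S n i - S k i ∥ + tail n ≤⟨ block+tail K≤i (j ℕ.∸ k) k K≤k ⟩
          tail k                     ∎)
        where n = (j ℕ.∸ k) ℕ.+ k

      -- The diagonal entries at m and n are compared through the k-th partial sum for one fixed k: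
      -- the blocks from k to m and from k to n are small, and the k-th partial sum is itself
      -- Cauchy.
      diagonal-cauchy : IsCauchy A (λ i → S i i)
      diagonal-cauchy ε 0<ε = k ℕ.⊔ L , λ m n k⊔L≤m k⊔L≤n →
        let k≤m = ℕ.m⊔n≤o⇒m≤o k L k⊔L≤m
            k≤n = ℕ.m⊔n≤o⇒m≤o k L k⊔L≤n
            L≤m = ℕ.m⊔n≤o⇒n≤o k L k⊔L≤m
            L≤n = ℕ.m⊔n≤o⇒n≤o k L k⊔L≤n
        in begin-strict
        ∥ S m m - S n n ∥
          ≡⟨ cong ∥_∥ (solve 4 (λ x y z w → x :- w := (x :- y) :+ (z :- w) :+ (y :- z))
                        refl (S m m) (S k m) (S k n) (S n n)) ⟩
        ∥ (S m m - S k m) + (S k n - S n n) + (S k m - S k n) ∥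
          ≤⟨ ∥+∥ ((S m m - S k m) + (S k n - S n n)) (S k m - S k n) ⟩
        ∥ (S m m - S k m) + (S k n - S n n) ∥ + ∥ S k m - S k n ∥
          <⟨ ℚ.+-mono-≤-< (ℚ.≤-trans (∥+∥ (S m m - S k m) (S k n - S n n))
               (ℚ.+-mono-≤ (at m k≤m)
                 (ℚ.≤-trans (ℚ.≤-reflexive (∥a-b∥≡∥b-a∥ (S k n) (S n n))) (at n k≤n))))
               (proj₂ S-close m n L≤m L≤n) ⟩
        ½ * (½ * ε) + ½ * (½ * ε) + ½ * ε
          ≡⟨ cong (_+ ½ * ε) (half+half (½ * ε)) ⟩
        ½ * ε + ½ * ε
          ≡⟨ half+half ε ⟩
        ε ∎
        where
          open +-*-Solver
          -- A quarter of ε for each of the two blocks leaves half of ε for the k-th partial sum.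
          tail-small = geometric-null (M + M) (half-positive (half-positive 0<ε))
          K₁ = proj₁ tail-small
          k = K ℕ.⊔ K₁
          S-close = cauchy (partialSum t k) (½ * ε) (half-positive 0<ε)
          L = proj₁ S-close
          at : ∀ i → k ℕ.≤ i → ∥ S i i - S k i ∥ ≤ ½ * (½ * ε)
          at i k≤i = ℚ.≤-trans
            (block-≤ (ℕ.m⊔n≤o⇒m≤o K K₁ k≤i) (ℕ.m≤m⊔n K K₁) k≤i)
            (ℚ.<⇒≤ (proj₂ tail-small k (ℕ.m≤n⊔m K K₁)))

    geometric-majorant⇒converges : SeriesConverges t
    geometric-majorant⇒converges = completed (λ i → S i i) diagonal-cauchy , limit
      where
        limit : partialSum t ⟶ completed (λ i → S i i) diagonal-cauchy
        limit ε 0<ε =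
          let K₁ , small = geometric-null (M + M) (half-positive 0<ε)
          in K ℕ.⊔ K₁ , λ k K⊔K₁≤k →
          let K≤k  = ℕ.m⊔n≤o⇒m≤o K K₁ K⊔K₁≤k
              K₁≤k = ℕ.m⊔n≤o⇒n≤o K K₁ K⊔K₁≤k
          -- The relation `_<ʳ_` asks for a rational gap: half of ε is the gap, and the tail takes
          -- the other half. Restricting to i at least k lets `block-≤` compare the diagonal entry
          -- with the k-th partial sum.
          in ½ * ε , half-positive 0<ε , k , λ i k≤i → begin
            ∥ S k i - S i i ∥ + ½ * ε ≡⟨ cong (_+ ½ * ε) (∥a-b∥≡∥b-a∥ (S k i) (S i i)) ⟩
            ∥ S i i - S k i ∥ + ½ * ε ≤⟨ ℚ.+-monoˡ-≤ (½ * ε) (ℚ.≤-trans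
                                           (block-≤ (ℕ.≤-trans K≤k k≤i) K≤k k≤i)
                                           (ℚ.<⇒≤ (small k K₁≤k))) ⟩
            ½ * ε + ½ * ε             ≡⟨ half+half ε ⟩
            ε                         ∎

-- The size of the coefficients.

module _ (ε q : ℚ) .{{_ : Positive q}} (γ δ N n : ℕ) where
  private
    m = γ ℕ.* n ℕ.+ δ
    f = fromℕ (m !)
    D = q + fromℕ ((m !) ℕ.^ (N ℕ.* m))
    P = fromℕ ((m !) ℕ.^ m)
    c = φ-coefficient ε q γ δ N n
    instance
      _ = m ℕ.!≢0
      D>0 : Positive D
      D>0 = ℚ.pos+nonNeg⇒pos q (fromℕ ((m !) ℕ.^ (N ℕ.* m)))
        {{ℚ.normalize-nonNeg ((m !) ℕ.^ (N ℕ.* m)) 1}}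
      _ = ℚ.pos⇒nonZero D

  -- Clearing denominators gives a multiplicative identity to which any absolute value applies; the
  -- one remaining sum is inside `D`.
  φ-coefficient-*-denominator :
    φ-coefficient ε q γ δ N n * (D * f) ≡ ε ^ n * fromℕ ((m !) ℕ.^ m)
  φ-coefficient-*-denominator = begin-equality
    ε ^ n * (P * 1/ D) * u * (D * f)    ≡⟨ solve 6 (λ e p i u d f →
                                             e :* (p :* i) :* u :* (d :* f) := e :* p :* ((d :* i) :* (f :* u)))
                                             refl (ε ^ n) P (1/ D) u D f ⟩
    ε ^ n * P * ((D * 1/ D) * (f * u))  ≡⟨ cong₂ (λ a b → ε ^ n * P * (a * b))
                                             (ℚ.*-inverseʳ D) (fromℕ-inverse (m !)) ⟩
    ε ^ n * P * 1ℚ                      ≡⟨ ℚ.*-identityʳ (ε ^ n * P) ⟩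
    ε ^ n * P                           ∎
    where
      open +-*-Solver
      u = + 1 / (m !)

  module _ (A : AbsoluteValue) (ε=±1 : ε ≡ 1ℚ ⊎ ε ≡ - 1ℚ) where
    open AbsoluteValue A

    ∥φ-coefficient∥-*-denominator : ∥ c ∥ * (∥ D ∥ * ∥ f ∥) ≡ ∥ f ∥ ^ m
    ∥φ-coefficient∥-*-denominator = begin-equality
      ∥ c ∥ * (∥ D ∥ * ∥ f ∥)  ≡⟨ cong (λ a → ∥ c ∥ * a) (∥*∥ D f) ⟨
      ∥ c ∥ * ∥ D * f ∥        ≡⟨ ∥*∥ c (D * f) ⟨
      ∥ c * (D * f) ∥          ≡⟨ cong ∥_∥ φ-coefficient-*-denominator ⟩
      ∥ ε ^ n * P ∥            ≡⟨ ∥*∥ (ε ^ n) P ⟩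
      ∥ ε ^ n ∥ * ∥ P ∥        ≡⟨ cong₂ _*_ ∥ε^n∥≡1 (trans (cong ∥_∥ (fromℕ-^ (m !) m)) (∥^∥ A f m)) ⟩
      1ℚ * ∥ f ∥ ^ m           ≡⟨ ℚ.*-identityˡ (∥ f ∥ ^ m) ⟩
      ∥ f ∥ ^ m                ∎
      where
        ∥ε^n∥≡1 : ∥ ε ^ n ∥ ≡ 1ℚ
        ∥ε^n∥≡1 = trans (∥^∥ A ε n) (trans (cong (_^ n) (∥±1∥≡1 A ε=±1)) (1^n≡1 n))

  -- Since N and m! are at least 1, `f ^ m ≤ D`. Putting `f ^ m` for `D` in
  -- `∥φ-coefficient∥-*-denominator` leaves a common factor `f ^ m` to cancel.
  ∣φ-coefficient∣*m!≤1 : .{{_ : NonZero N}} → ε ≡ 1ℚ ⊎ ε ≡ - 1ℚ → ℚ.∣ c ∣ * f ≤ 1ℚ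
  ∣φ-coefficient∣*m!≤1 ε=±1 = ℚ.*-cancelʳ-≤-pos (f ^ m) {{positive (^-positive (ℚ.positive⁻¹ f) m)}} (begin
    ℚ.∣ c ∣ * f * f ^ m           ≡⟨ solve 3 (λ c f p → c :* f :* p := c :* (p :* f))
                                       refl ℚ.∣ c ∣ f (f ^ m) ⟩
    ℚ.∣ c ∣ * (f ^ m * f)         ≤⟨ ℚ.*-monoˡ-≤-nonNeg ℚ.∣ c ∣ {{nonNegative (ℚ.0≤∣p∣ c)}}
                                       (ℚ.*-monoʳ-≤-nonNeg f {{ℚ.pos⇒nonNeg f}} f^m≤D) ⟩
    ℚ.∣ c ∣ * (D * f)             ≡⟨ cong₂ (λ a b → ℚ.∣ c ∣ * (a * b)) (∣∣-positive D) (∣∣-positive f) ⟨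
    ℚ.∣ c ∣ * (ℚ.∣ D ∣ * ℚ.∣ f ∣) ≡⟨ ∥φ-coefficient∥-*-denominator usual ε=±1 ⟩
    ℚ.∣ f ∣ ^ m                   ≡⟨ cong (_^ m) (∣∣-positive f) ⟩
    f ^ m                         ≡⟨ ℚ.*-identityˡ (f ^ m) ⟨
    1ℚ * f ^ m                    ∎)
    where
      open +-*-Solver
      instance
        f>0 : Positive f
        f>0 = fromℕ-positive (m !)
      ∣∣-positive : ∀ a .{{_ : Positive a}} → ℚ.∣ a ∣ ≡ a
      ∣∣-positive a = ℚ.0≤p⇒∣p∣≡p (ℚ.<⇒≤ (ℚ.positive⁻¹ a))
      f^m≤D : f ^ m ≤ D
      f^m≤D = begin
        f ^ m                                 ≡⟨ fromℕ-^ (m !) m ⟨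
        fromℕ ((m !) ℕ.^ m)                   ≤⟨ fromℕ-mono-≤ (ℕ.^-monoʳ-≤ (m !) (ℕ.m≤n*m m N)) ⟩
        fromℕ ((m !) ℕ.^ (N ℕ.* m))           ≡⟨ ℚ.+-identityˡ (fromℕ ((m !) ℕ.^ (N ℕ.* m))) ⟨
        0ℚ + fromℕ ((m !) ℕ.^ (N ℕ.* m))      ≤⟨ ℚ.+-monoˡ-≤ (fromℕ ((m !) ℕ.^ (N ℕ.* m)))
                                                   (ℚ.<⇒≤ (ℚ.positive⁻¹ q)) ⟩
        D                                     ∎

-- Up to m = c the power is at most `c ^ c`; beyond that, each further factor c is smaller than the
-- new factor of the factorial.
c^m≤c^c*m! : ∀ c .{{_ : NonZero c}} m → c ℕ.^ m ℕ.≤ c ℕ.^ c ℕ.* m !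
c^m≤c^c*m! c m with m ℕ.≤? c
... | yes m≤c = ℕ.≤-trans (ℕ.^-monoʳ-≤ c m≤c) (ℕ.m≤m*n (c ℕ.^ c) (m !) {{m ℕ.!≢0}})
c^m≤c^c*m! c zero    | no 0≰c = contradiction ℕ.z≤n 0≰c
c^m≤c^c*m! c (suc m) | no m≰c = ℕ.≤-trans
  (ℕ.*-mono-≤ (ℕ.<⇒≤ (ℕ.≰⇒> m≰c)) (c^m≤c^c*m! c m))
  (ℕ.≤-reflexive (x∙yz≈y∙xz (suc m) (c ℕ.^ c) (m !)))

n≤γn+δ : ∀ γ δ n .{{_ : NonZero γ}} → n ℕ.≤ γ ℕ.* n ℕ.+ δ
n≤γn+δ γ δ n = ℕ.≤-trans (ℕ.m≤n*m n γ) (ℕ.m≤m+n (γ ℕ.* n) δ)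

-- To be read with c, d and r the absolute values of the coefficient, of q + f^(Nm) and of f, with b
-- a bound for |x| and h a lower bound for d. Cancelling one r gives c d = r^(m-1), which pairs with
-- b^(m-1); the spare b and the exponent m - 1 account for the constant `b + b`.
coefficient-estimate : ∀ {c d r b h} → 0ℚ ≤ c → 0ℚ < r → 0ℚ ≤ b → h ≤ d → r * b ≤ ½ →
  ∀ m .{{_ : NonZero m}} → c * (d * r) ≡ r ^ m → c * b ^ m * h ≤ (b + b) * ½ ^ m
coefficient-estimate {c} {d} {r} {b} {h} 0≤c 0<r 0≤b h≤d rb≤½ (suc m) c*dr≡ = begin
  c * (b * b ^ m) * h       ≡⟨ solve 4 (λ c b p h → c :* (b :* p) :* h := c :* h :* (p :* b))
                                 refl c b (b ^ m) h ⟩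
  c * h * (b ^ m * b)       ≤⟨ ℚ.*-monoʳ-≤-nonNeg (b ^ m * b)
                                 {{nonNegative (*-nonneg (^-nonneg 0≤b m) 0≤b)}} c*h≤r^m ⟩
  r ^ m * (b ^ m * b)       ≡⟨ ℚ.*-assoc (r ^ m) (b ^ m) b ⟨
  r ^ m * b ^ m * b         ≡⟨ cong (_* b) (^-distrib-* r b m) ⟨
  (r * b) ^ m * b           ≤⟨ ℚ.*-monoʳ-≤-nonNeg b {{nonNegative 0≤b}}
                                 (^-mono-≤ (*-nonneg (ℚ.<⇒≤ 0<r) 0≤b) rb≤½ m) ⟩
  ½ ^ m * b                 ≡⟨ solve 2 (λ p b → p :* b := (b :+ b) :* (con ½ :* p)) refl (½ ^ m) b ⟩
  (b + b) * (½ * ½ ^ m)     ∎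
  where
    open +-*-Solver
    c*d≡r^m : c * d ≡ r ^ m
    c*d≡r^m = *-cancelʳ-≡-pos r {{positive 0<r}}
      (trans (ℚ.*-assoc c d r) (trans c*dr≡ (ℚ.*-comm r (r ^ m))))
    c*h≤r^m : c * h ≤ r ^ m
    c*h≤r^m = ℚ.≤-trans (ℚ.*-monoˡ-≤-nonNeg c {{nonNegative 0≤c}} h≤d) (ℚ.≤-reflexive c*d≡r^m)

-- The one property of the p-adic absolute values on which their coefficient estimates rest.
VanishingFactorials : AbsoluteValue → Set
VanishingFactorials A = ∀ {η} → 0ℚ < η → ∃[ K ] (∀ m → K ℕ.≤ m → ∥ fromℕ (m !) ∥ ≤ η)
  where open AbsoluteValue A

-- Geometric majorants for the series.

module _ (ε : ℚ) (ε=±1 : ε ≡ 1ℚ ⊎ ε ≡ - 1ℚ) (q : ℚ) .{{_ : Positive q}}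
         (γ δ N : ℕ) .{{_ : NonZero γ}} .{{_ : NonZero N}} where
  private
    m : ℕ → ℕ
    m n = γ ℕ.* n ℕ.+ δ

    c : ℕ → ℚ
    c = φ-coefficient ε q γ δ N

  -- The number `b` stands for a bound on the late approximants of x, so `M` and `K` depend on x
  -- only through `b`.
  GeometricMajorants : AbsoluteValue → Set
  GeometricMajorants A = ∀ b .{{_ : NonZero b}} →
    ∃[ M ] (0ℚ ≤ M × (∃[ K ] ∀ n → K ℕ.≤ n → ∥ c n ∥ * fromℕ b ^ m n ≤ M * ½ ^ n))
    where open AbsoluteValue A

  -- A Cauchy sequence is eventually bounded, so a single b bounds all late approximants of x, and
  -- the majorant for this b serves them all.
  geometricMajorants⇒converges : ∀ A → GeometricMajorants A → ∀ x → φ-ConvergesAt A ε q γ δ N x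
  geometricMajorants⇒converges A majorants x =
    geometric-majorant⇒converges A t (K₁ ℕ.⊔ K₂) {M} (proj₁ (proj₂ majorant)) λ n i K≤n K≤i →
      term≤ n i (ℕ.m⊔n≤o⇒n≤o K₁ K₂ K≤n) (ℕ.m⊔n≤o⇒m≤o K₁ K₂ K≤i)
    where
      open AbsoluteValue A
      open AbsoluteValueProperties A using (eventually-bounded)
      open CompletionOperations A
      t = φ-term A ε q γ δ N x
      bounded = eventually-bounded {approx x} (cauchy x)
      K₁ = proj₁ bounded
      large = archimedean (proj₁ (proj₂ bounded))
      -- The successor makes `b` nonzero, as `GeometricMajorants` demands.
      b = suc (proj₁ large)
      majorant = majorants b
      M = proj₁ majorant
      K₂ = proj₁ (proj₂ (proj₂ majorant))
      x≤b : ∀ i → K₁ ℕ.≤ i → ∥ approx x i ∥ ≤ fromℕ b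
      x≤b i K₁≤i = ℚ.≤-trans (proj₂ (proj₂ (proj₂ bounded)) i K₁≤i)
        (ℚ.≤-trans (proj₂ large) (fromℕ-mono-≤ (ℕ.n≤1+n (proj₁ large))))
      term≤ : ∀ n i → K₂ ℕ.≤ n → K₁ ℕ.≤ i → ∥ approx (t n) i ∥ ≤ M * ½ ^ n
      term≤ n i K₂≤n K₁≤i = begin
        ∥ c n * approx (x ^ᶜ m n) i ∥     ≡⟨ ∥*∥ (c n) (approx (x ^ᶜ m n) i) ⟩
        ∥ c n ∥ * ∥ approx (x ^ᶜ m n) i ∥ ≡⟨ cong (λ a → ∥ c n ∥ * a) (∥approx-^∥ A x (m n) i) ⟩
        ∥ c n ∥ * ∥ approx x i ∥ ^ m n    ≤⟨ ℚ.*-monoˡ-≤-nonNeg (∥ c n ∥) {{nonNegative 0≤∥ c n ∥}}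
                                               (^-mono-≤ 0≤∥ approx x i ∥ (x≤b i K₁≤i) (m n)) ⟩
        ∥ c n ∥ * fromℕ b ^ m n           ≤⟨ proj₂ (proj₂ (proj₂ majorant)) n K₂≤n ⟩
        M * ½ ^ n                         ∎

  ½^m≤½^n : ∀ {M} → 0ℚ ≤ M → ∀ n → M * ½ ^ m n ≤ M * ½ ^ n
  ½^m≤½^n {M} 0≤M n = ℚ.*-monoˡ-≤-nonNeg M {{nonNegative 0≤M}} (½^-antitone (n≤γn+δ γ δ n))

  -- Writing b as half of 2b yields the factor `½ ^ m n`. The remaining power of 2b is at most M
  -- times the factorial, which the coefficient absorbs.
  usual-majorants : GeometricMajorants usual
  usual-majorants b = M , 0≤M , 0 , λ n _ → begin
    ℚ.∣ c n ∣ * fromℕ b ^ m n                 ≤⟨ ℚ.*-monoˡ-≤-nonNeg ℚ.∣ c n ∣ {{nonNegative (ℚ.0≤∣p∣ (c n))}}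
                                                   (b^m≤ (m n)) ⟩
    ℚ.∣ c n ∣ * (½ ^ m n * (M * fromℕ (m n !))) ≡⟨ solve 4 (λ c h M f → c :* (h :* (M :* f)) := c :* f :* (M :* h))
                                                   refl ℚ.∣ c n ∣ (½ ^ m n) M (fromℕ (m n !)) ⟩
    ℚ.∣ c n ∣ * fromℕ (m n !) * (M * ½ ^ m n) ≤⟨ ℚ.*-monoʳ-≤-nonNeg (M * ½ ^ m n)
                                                   {{nonNegative (*-nonneg 0≤M (^-nonneg 0≤½ (m n)))}}
                                                   (∣φ-coefficient∣*m!≤1 ε q γ δ N n ε=±1) ⟩
    1ℚ * (M * ½ ^ m n)                        ≡⟨ ℚ.*-identityˡ (M * ½ ^ m n) ⟩
    M * ½ ^ m n                               ≤⟨ ½^m≤½^n 0≤M n ⟩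
    M * ½ ^ n                                 ∎
    where
      open +-*-Solver
      -- The constant of `c^m≤c^c*m!` for the base 2b.
      M = fromℕ ((2 ℕ.* b) ℕ.^ (2 ℕ.* b))
      0≤M = fromℕ-nonneg ((2 ℕ.* b) ℕ.^ (2 ℕ.* b))
      instance _ = ℕ.m*n≢0 2 b
      b≡ : fromℕ b ≡ ½ * fromℕ (2 ℕ.* b)
      b≡ = begin-equality
        fromℕ b               ≡⟨ ℚ.*-identityˡ (fromℕ b) ⟨
        ½ * fromℕ 2 * fromℕ b ≡⟨ ℚ.*-assoc ½ (fromℕ 2) (fromℕ b) ⟩
        ½ * (fromℕ 2 * fromℕ b) ≡⟨ cong (½ *_) (fromℕ-* 2 b) ⟨
        ½ * fromℕ (2 ℕ.* b)   ∎
      b^m≤ : ∀ k → fromℕ b ^ k ≤ ½ ^ k * (M * fromℕ (k !))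
      b^m≤ k = begin
        fromℕ b ^ k                          ≡⟨ cong (_^ k) b≡ ⟩
        (½ * fromℕ (2 ℕ.* b)) ^ k            ≡⟨ ^-distrib-* ½ (fromℕ (2 ℕ.* b)) k ⟩
        ½ ^ k * fromℕ (2 ℕ.* b) ^ k          ≡⟨ cong (½ ^ k *_) (fromℕ-^ (2 ℕ.* b) k) ⟨
        ½ ^ k * fromℕ ((2 ℕ.* b) ℕ.^ k)      ≤⟨ ℚ.*-monoˡ-≤-nonNeg (½ ^ k) {{nonNegative (^-nonneg 0≤½ k)}}
                                                  (fromℕ-mono-≤ (c^m≤c^c*m! (2 ℕ.* b) k)) ⟩
        ½ ^ k * fromℕ ((2 ℕ.* b) ℕ.^ (2 ℕ.* b) ℕ.* k !)
                                             ≡⟨ cong (½ ^ k *_) (fromℕ-* ((2 ℕ.* b) ℕ.^ (2 ℕ.* b)) (k !)) ⟩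
        ½ ^ k * (M * fromℕ (k !))            ∎

  vanishing⇒majorants : ∀ A → VanishingFactorials A → GeometricMajorants A
  vanishing⇒majorants A vanishing b = M , 0≤M , K , c*b^m≤
    where
      open AbsoluteValue A
      open AbsoluteValueProperties A
      instance
        q>0 : Positive ∥ q ∥
        q>0 = ∥∥-positive A q (pos⇒≢0 q)
        b>0 : Positive (fromℕ b)
        b>0 = fromℕ-positive b
        _ = ℚ.pos⇒nonZero (fromℕ b)
      0≤b = fromℕ-nonneg b

      h : ℚ
      h = ½ * ∥ q ∥

      0<h : 0ℚ < h
      0<h = half-positive (ℚ.positive⁻¹ ∥ q ∥)

      instance
        h>0 : Positive h
        h>0 = positive 0<h
        _ = ℚ.pos⇒nonZero h

      -- The constant of `coefficient-estimate`, divided by the lower bound `h` that appears there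
      -- as a factor.
      M : ℚ
      M = 1/ h * (fromℕ b + fromℕ b)

      0≤M : 0ℚ ≤ M
      0≤M = *-nonneg (ℚ.<⇒≤ (1/-positive h)) (ℚ.+-mono-≤ 0≤b 0≤b)

      -- Three demands on the absolute value of m!: at most 1, so that its powers do not grow; at
      -- most h, to keep that of `F` within half of |q|; at most 1/(2b), for the ratio ½.
      small₁ = vanishing 0<1
      small₂ = vanishing 0<h
      small₃ = vanishing (half-positive (1/-positive (fromℕ b)))
      K₁ = proj₁ small₁
      K₂ = proj₁ small₂
      K₃ = proj₁ small₃
      -- The 1 forces m to be positive, so that `F` has a positive exponent and
      -- `coefficient-estimate` applies.
      K = 1 ℕ.⊔ (K₁ ℕ.⊔ (K₂ ℕ.⊔ K₃))

      module _ (n : ℕ) (K≤n : K ℕ.≤ n) where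
        K≤m = ℕ.≤-trans K≤n (n≤γn+δ γ δ n)
        f = fromℕ (m n !)
        F = fromℕ ((m n !) ℕ.^ (N ℕ.* m n))
        instance
          m≢0 : NonZero (m n)
          m≢0 = ℕ.>-nonZero (ℕ.m⊔n≤o⇒m≤o 1 (K₁ ℕ.⊔ (K₂ ℕ.⊔ K₃)) K≤m)
          Nm≢0 : NonZero (N ℕ.* m n)
          Nm≢0 = ℕ.m*n≢0 N (m n)
          m!≢0 : NonZero (m n !)
          m!≢0 = m n ℕ.!≢0

        K₁₂₃≤m = ℕ.m⊔n≤o⇒n≤o 1 (K₁ ℕ.⊔ (K₂ ℕ.⊔ K₃)) K≤m
        K₂₃≤m = ℕ.m⊔n≤o⇒n≤o K₁ (K₂ ℕ.⊔ K₃) K₁₂₃≤m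

        ∥f∥≤1 : ∥ f ∥ ≤ 1ℚ
        ∥f∥≤1 = proj₂ small₁ (m n) (ℕ.m⊔n≤o⇒m≤o K₁ (K₂ ℕ.⊔ K₃) K₁₂₃≤m)

        ∥f∥≤h : ∥ f ∥ ≤ h
        ∥f∥≤h = proj₂ small₂ (m n) (ℕ.m⊔n≤o⇒m≤o K₂ K₃ K₂₃≤m)

        ∥f∥b≤½ : ∥ f ∥ * fromℕ b ≤ ½
        ∥f∥b≤½ = begin
          ∥ f ∥ * fromℕ b              ≤⟨ ℚ.*-monoʳ-≤-nonNeg (fromℕ b) {{nonNegative 0≤b}}
                                            (proj₂ small₃ (m n) (ℕ.m⊔n≤o⇒n≤o K₂ K₃ K₂₃≤m)) ⟩
          ½ * 1/ fromℕ b * fromℕ b     ≡⟨ ℚ.*-assoc ½ (1/ fromℕ b) (fromℕ b) ⟩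
          ½ * (1/ fromℕ b * fromℕ b)   ≡⟨ cong (½ *_) (ℚ.*-inverseˡ (fromℕ b)) ⟩
          ½                            ∎

        ∥F∥≤h : ∥ F ∥ ≤ h
        ∥F∥≤h = begin
          ∥ F ∥                   ≡⟨ trans (cong ∥_∥ (fromℕ-^ (m n !) (N ℕ.* m n))) (∥^∥ A f (N ℕ.* m n)) ⟩
          ∥ f ∥ ^ (N ℕ.* m n)     ≤⟨ ^-antitone 0≤∥ f ∥ ∥f∥≤1 (ℕ.>-nonZero⁻¹ (N ℕ.* m n)) ⟩
          ∥ f ∥ * 1ℚ              ≡⟨ ℚ.*-identityʳ (∥ f ∥) ⟩
          ∥ f ∥                   ≤⟨ ∥f∥≤h ⟩
          h                       ∎

        -- By the triangle inequality |q| is at most |q + F| + |F|, and |F| uses up at most half of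
        -- |q|.
        h≤∥q+F∥ : h ≤ ∥ q + F ∥
        h≤∥q+F∥ = begin
          h                                ≡⟨ solve 1 (λ h → h := h :+ h :- h) refl h ⟩
          h + h - h                        ≡⟨ cong (_- h) (half+half (∥ q ∥)) ⟩
          ∥ q ∥ - h                        ≤⟨ ℚ.+-monoˡ-≤ (- h) (∥a∥≤∥b∥+∥a-b∥ q (q + F)) ⟩
          ∥ q + F ∥ + ∥ q - (q + F) ∥ - h  ≡⟨ cong (λ a → ∥ q + F ∥ + a - h) ∥q-[q+F]∥≡∥F∥ ⟩
          ∥ q + F ∥ + ∥ F ∥ - h            ≤⟨ ℚ.+-monoˡ-≤ (- h) (ℚ.+-monoʳ-≤ (∥ q + F ∥) ∥F∥≤h) ⟩
          ∥ q + F ∥ + h - h                ≡⟨ solve 2 (λ d h → d :+ h :- h := d) refl (∥ q + F ∥) h ⟩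
          ∥ q + F ∥                        ∎
          where
            open +-*-Solver
            ∥q-[q+F]∥≡∥F∥ : ∥ q - (q + F) ∥ ≡ ∥ F ∥
            ∥q-[q+F]∥≡∥F∥ = trans
              (cong ∥_∥ (solve 2 (λ q F → q :- (q :+ F) := :- F) refl q F)) (∥-a∥≡∥a∥ F)

        0<∥f∥ : 0ℚ < ∥ f ∥
        0<∥f∥ = ℚ.positive⁻¹ ∥ f ∥ {{∥∥-positive A f (pos⇒≢0 f {{fromℕ-positive (m n !)}})}}

        c*b^m≤ : ∥ c n ∥ * fromℕ b ^ m n ≤ M * ½ ^ n
        c*b^m≤ = begin
          x                              ≡⟨ ℚ.*-identityʳ x ⟨
          x * 1ℚ                         ≡⟨ cong (x *_) (ℚ.*-inverseʳ h) ⟨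
          x * (h * 1/ h)                 ≡⟨ ℚ.*-assoc x h (1/ h) ⟨
          x * h * 1/ h                   ≤⟨ ℚ.*-monoʳ-≤-nonNeg (1/ h) {{nonNegative (ℚ.<⇒≤ (1/-positive h))}}
                                              (coefficient-estimate 0≤∥ c n ∥ 0<∥f∥ 0≤b h≤∥q+F∥ ∥f∥b≤½ (m n)
                                                (∥φ-coefficient∥-*-denominator ε q γ δ N n A ε=±1)) ⟩
          (fromℕ b + fromℕ b) * ½ ^ m n * 1/ h ≡⟨ solve 3 (λ b p i → b :* p :* i := i :* b :* p)
                                              refl (fromℕ b + fromℕ b) (½ ^ m n) (1/ h) ⟩
          M * ½ ^ m n                    ≤⟨ ½^m≤½^n 0≤M n ⟩
          M * ½ ^ n                      ∎
          where
            open +-*-Solver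
            x = ∥ c n ∥ * fromℕ b ^ m n

-- The p-adic size of factorials.

module _ (p : ℕ) (pp : Prime p) where
  open Padic p pp using (1<p; ord; ord-∣; ord-greatest; p^_/p^_; fracAbs; ∣_∣ₚ; ∣∣ₚ-of-≃)
  private instance
    p≢0 : NonZero p
    p≢0 = prime⇒nonZero pp

  -- Binomial coefficients are integers, so p! (kp)! divides (p + kp)!, and p! contributes a further
  -- factor p.
  p^k∣[kp]! : ∀ k → p ℕ.^ k ∣ (k ℕ.* p) !
  p^k∣[kp]! zero    = 1∣ 1
  p^k∣[kp]! (suc k) = ∣-trans (*-pres-∣ (n∣n! p) (p^k∣[kp]! k))
    (subst (λ n → p ! ℕ.* n ! ∣ (p ℕ.+ k ℕ.* p) !) (ℕ.m+n∸m≡n p (k ℕ.* p))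
      (k![n∸k]!∣n! (ℕ.m≤m+n p (k ℕ.* p))))
    where
      n∣n! : ∀ n .{{_ : NonZero n}} → n ∣ n !
      n∣n! (suc n) = m∣m*n (n !)

  -- Passing to an unnormalised fraction avoids computing the reduced form of n / 1.
  ∣fromℕ∣ₚ : ∀ n → ∣ fromℕ n ∣ₚ ≡ fracAbs n 1
  ∣fromℕ∣ₚ n = ∣∣ₚ-of-≃ (fromℕ n) (+ n) 0 (ℚ.toℚᵘ-fromℚᵘ (mkℚᵘ (+ n) 0))

  ½^k≡1/2^k : ∀ k → ½ ^ k ≡ (+ 1 / 2 ℕ.^ k) {{ℕ.m^n≢0 2 k}}
  ½^k≡1/2^k k = *-cancelʳ-≡-pos (fromℕ (2 ℕ.^ k)) {{fromℕ-positive (2 ℕ.^ k)}}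
    (trans (½^n*2^n≡1 k) (sym (trans (ℚ.*-comm _ (fromℕ (2 ℕ.^ k))) (fromℕ-inverse (2 ℕ.^ k)))))
    where instance _ = ℕ.m^n≢0 2 k

  -- As p is at least 2, the bound p^(-k) weakens to `½ ^ k`, the form that `geometric-null`
  -- controls for all p alike.
  p^k∣n⇒∣n∣ₚ≤½^k : ∀ n .{{_ : NonZero n}} k → p ℕ.^ k ∣ n → ∣ fromℕ n ∣ₚ ≤ ½ ^ k
  p^k∣n⇒∣n∣ₚ≤½^k n@(suc _) k p^k∣n = begin
    ∣ fromℕ n ∣ₚ          ≡⟨ ∣fromℕ∣ₚ n ⟩
    p^ ord 1 /p^ ord n    ≤⟨ /-≤ (p ℕ.^ ord 1) (p ℕ.^ ord n) 1 (2 ℕ.^ k)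
                               -- `p ^ ord 1` divides 1, so the numerator is at most 1.
                               (ℕ.*-mono-≤ (∣⇒≤ (ord-∣ 1))
                                 (ℕ.≤-trans (ℕ.^-monoˡ-≤ k 1<p) (ℕ.^-monoʳ-≤ p (ord-greatest n k p^k∣n)))) ⟩
    + 1 / 2 ℕ.^ k         ≡⟨ ½^k≡1/2^k k ⟨
    ½ ^ k                 ∎
    where
      instance
        _ = ℕ.m^n≢0 p (ord n)
        _ = ℕ.m^n≢0 2 k

  -- With `½ ^ K` below η, every m from Kp on works: p^K divides (Kp)!, which divides m!.
  padic-vanishing : VanishingFactorials (padic p pp)
  padic-vanishing {η} 0<η = K ℕ.* p , λ m Kp≤m → begin
    ∣ fromℕ (m !) ∣ₚ  ≤⟨ p^k∣n⇒∣n∣ₚ≤½^k (m !) {{m ℕ.!≢0}} K (∣-trans (p^k∣[kp]! K) (m≤n⇒m!∣n! Kp≤m)) ⟩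
    ½ ^ K             ≡⟨ ℚ.*-identityˡ (½ ^ K) ⟨
    1ℚ * ½ ^ K        ≤⟨ ℚ.<⇒≤ (proj₂ null K ℕ.≤-refl) ⟩
    η                 ∎
    where
      null = geometric-null 1ℚ 0<η
      K = proj₁ null

theorem4p8 : (ε : ℚ) → ε ≡ 1ℚ ⊎ ε ≡ - 1ℚ →
    (q : ℚ) → .{{_ : Positive q}} →
    (γ δ N : ℕ) → .{{_ : NonZero γ}} → .{{_ : NonZero N}} →
    ((x : ℝ) → φ-ConvergesAt usual ε q γ δ N x) ×
    ((p : ℕ) → (pp : Prime p) → (x : ℚₚ p pp) → φ-ConvergesAt (padic p pp) ε q γ δ N x)
theorem4p8 ε ε=±1 q {{q>0}} γ δ N {{γ≢0}} {{N≢0}} =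
  geometricMajorants⇒converges ε ε=±1 q {{q>0}} γ δ N {{γ≢0}} {{N≢0}} usual
    (usual-majorants ε ε=±1 q {{q>0}} γ δ N {{γ≢0}} {{N≢0}}) ,
  λ p pp → geometricMajorants⇒converges ε ε=±1 q {{q>0}} γ δ N {{γ≢0}} {{N≢0}} (padic p pp)
    (vanishing⇒majorants ε ε=±1 q {{q>0}} γ δ N {{γ≢0}} {{N≢0}} (padic p pp) (padic-vanishing p pp))
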